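{- Fix an integer $n\ge 1$. (i) Let $m_1,m_2,k_1,k_2$ be integers with $1\le m_1\le m_2$ and $0\le k_1\le k_2$. The mappings $\phi_{(m_2,m_1)}:\Lambda_{m_2,\cdot}\to\Lambda_{m_1,\cdot}$ and $\psi_{(k_2,k_1)}:\Lambda_{\cdot,k_2}\to\Lambda_{\cdot,k_1}$ whose degree-$r$ components ($r\ge 0$) are $$\phi^r_{(m_2,m_1)}=h^r_{m_1+1}\circ h^r_{m_1+2}\circ\dots\circ h^r_{m_2},\qquad \psi^r_{(k_2,k_1)}=v^r_{k_1+1}\circ v^r_{k_1+2}\circ\dots\circ v^r_{k_2}$$ (the identity if $m_1=m_2$, respectively $k_1=k_2$) are surjective homomorphisms of graded rings, and $(\phi_{(m_2,m_1)})$ and $(\psi_{(k_2,k_1)})$ are directed families of homomorphisms of graded rings. Furthermore, the inverse limits induced by these families are equal (up to canonical isomorphism of graded rings): $$\varprojlim_{m}\Lambda_{m,\cdot}=\Lambda=\varprojlim_{k}\Lambda_{\cdot,k}.$$ (ii) For every integer $m\ge 1$ the mapping $H_m:\Lambda\to\Lambda_{m,\cdot}$ defined by setting $\mathbf a_{p\mu_1\dots\mu_d}=0$ for all $p>m$, all $d\ge 0$ and all $\mu_i$ is a surjective homomorphism of graded rings. For every integer $k\ge 0$ the mapping $V_k:\Lambda\to\Lambda_{\cdot,k}$ defined by setting $\mathbf a_{p\mu_1\dots\mu_d}=0$ for all $p\ge 1$, all $d>k$ and all $\mu_i$ is a surjective homomorphism of graded rings.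
   Context: Indeterminates: for integers $p\ge 1$, $d\ge 0$ and $1\le\mu_1,\dots,\mu_d\le n$ let $\mathbf a_{p\mu_1\dots\mu_d}$ be independent indeterminates (for $d=0$ this is $\mathbf a_p$). For $m\ge1$, $k\ge0$, $\Lambda_{m,k}$ is the graded ring of symmetric polynomials with coefficients in $\mathbb Z$ in the $mq_k$ indeterminates $\mathbf a_{p\mu_1\dots\mu_d}$ with $1\le p\le m$, $0\le d\le k$ (invariant under all permutations of these $mq_k$ indeterminates), where $q_k=\sum_{j=0}^k n^j$. $\Lambda_{m,k}^r$ is the additive group of homogeneous elements of degree $r$ (including $0$), so $\Lambda_{m,k}=\bigoplus_{r\ge0}\Lambda^r_{m,k}$. Projections: $h_{m+1,k}^r:\Lambda_{m+1,k}^r\to\Lambda_{m,k}^r$ sets $\mathbf a_{(m+1)\mu_1\dots\mu_d}=0$ for all $0\le d\le k$ and all $\mu_i$; $v_{m,k+1}^r:\Lambda_{m,k+1}^r\to\Lambda_{m,k}^r$ sets $\mathbf a_{p\mu_1\dots\mu_{k+1}}=0$ for all $1\le p\le m$ and all $\mu_i$. One-index limits: $\Lambda^r_{\cdot,k}=\varprojlim_m\Lambda^r_{m,k}$ (along the $h^r_{m,k}$, $m\ge 1$) and $\Lambda^r_{m,\cdot}=\varprojlim_k\Lambda^r_{m,k}$ (along the $v^r_{m,k}$, $k\ge 0$), realized as groups of compatible sequences; $\Lambda_{\cdot,k}=\bigoplus_{r\ge0}\Lambda_{\cdot,k}^r$ and $\Lambda_{m,\cdot}=\bigoplus_{r\ge0}\Lambda_{m,\cdot}^r$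 are graded rings. For $m\ge 2$, $h_m^r:\Lambda^r_{m,\cdot}\to\Lambda^r_{m-1,\cdot}$ is $(P_{m,k})_k\mapsto(h^r_{m,k}P_{m,k})_k$; for $k\ge 1$, $v_k^r:\Lambda^r_{\cdot,k}\to\Lambda^r_{\cdot,k-1}$ is $(P_{m,k})_m\mapsto(v^r_{m,k}P_{m,k})_m$. A directed family over a directed set $I$ is a family of morphisms $f_{(j,i)}:A_j\to A_i$ for $i\le j$ with $f_{(i,i)}=\mathrm{id}$ and $f_{(l,i)}\circ f_{(j,l)}=f_{(j,i)}$ for $i\le l\le j$. Inverse limits of graded rings are taken in the category of graded rings, i.e. the degree-$r$ component of the limit is the inverse limit of the degree-$r$ components, and the limit is the direct sum of these over $r\geq 0$. $\Lambda$ is the graded ring of symmetric functions over $\mathbb Z$ (the direct sum over $r$ of the inverse limits of the groups of homogeneous symmetric polynomials of degree $r$ in finitely many variables), where the countably many variables are taken to be all the $\mathbf a_{p\mu_1\dots\mu_d}$. "Canonical" means compatible with the projections to the rings $\Lambda_{m,k}$ obtained by setting to zero all the other indeterminates. An element of $\Lambda$ in which indeterminates have been set to zero is viewed in $\Lambda_{m,\cdot}$ or $\Lambda_{\cdot,k}$ as the sequence of its truncations. -}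

module Defs where

open import Level using (0ℓ)
open import Function using (_∘_; id)
open import Function.Bundles using (_↔_; _⇔_; mk⇔; Inverse; Equivalence)
open import Function.Definitions using (Surjective)
open import Data.Bool.Base using (true; false; if_then_else_)
open import Data.Fin.Base using (Fin)
import Data.Fin.Properties as Fin
open import Data.Integer.Base using (ℤ; 0ℤ; 1ℤ; _+_; _*_; -_)
import Data.Integer.Properties as ℤ
open import Data.List.Base
  using (List; []; _∷_; [_]; _++_; map; concatMap; length; upTo; allFin; cartesianProduct; cartesianProductWith)
import Data.List.Properties as List
open import Data.List.Membership.Propositional using (_∈_; _∉_; find; lose)
import Data.List.Membership.Propositional.Properties as ∈
open import Data.List.Relation.Binary.Permutation.Propositional using (_↭_; ↭-refl; ↭-sym; ↭-trans; prep)
import Data.List.Relation.Binary.Permutation.Propositional.Properties as ↭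
open import Data.List.Relation.Binary.Subset.Propositional using (_⊆_)
open import Data.List.Relation.Unary.All using (All; []; _∷_; all?)
import Data.List.Relation.Unary.All as All
import Data.List.Relation.Unary.All.Properties as All
open import Data.List.Relation.Unary.Any using (Any; here; there; any?)
import Data.List.Relation.Unary.Any as Any
import Data.List.Relation.Unary.Any.Properties as Any
open import Data.Nat.Base as ℕ using (ℕ; zero; suc; _≤_; _<_; z≤n; s≤s; _≤′_; ≤′-reflexive; ≤′-step)
import Data.Nat.Properties as ℕ
open import Data.Product.Properties using (≡-dec)
open import Data.Product.Base using (Σ; ∃; _×_; _,_; proj₁; proj₂)
open import Data.Sum.Base using (_⊎_; inj₁; inj₂)
open import Algebra.Bundles using (RawGroup; AbelianGroup)
open import Algebra.Structures using (IsAbelianGroup)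
open import Algebra.Morphism.Structures using (IsGroupHomomorphism)
import Algebra.Morphism.Construct.Composition as Composition
import Algebra.Morphism.Construct.Identity as Identity
open import Relation.Binary.Core using (Rel)
open import Relation.Binary.Definitions using (DecidableEquality; Reflexive; Symmetric; Transitive)
open import Relation.Binary.Structures using (IsPreorder)
open import Relation.Binary.PropositionalEquality
  using (_≡_; _≢_; refl; sym; trans; cong; cong₂; subst; isEquivalence; module ≡-Reasoning)
open import Relation.Nullary using (¬_; Dec; yes; no; does; contradiction; ¬?)
open import Relation.Nullary.Decidable using (map′; decidable-stable; dec-true; dec-false)
open import Relation.Unary using (Pred; Decidable)

module Polynomial {A : Set} (_≟_ : DecidableEquality A) where

  open import Data.List.Membership.DecPropositional _≟_ using (_∈?_)

  -- A monomial is a list of indeterminates, taken up to _↭_.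
  Monomial : Set
  Monomial = List A

  infix 4 _↭?_
  _↭?_ : (u w : Monomial) → Dec (u ↭ w)
  []      ↭? []      = yes ↭-refl
  []      ↭? (x ∷ w) = no λ p → ↭.¬x∷xs↭[] (↭-sym p)
  (a ∷ u) ↭? w with a ∈? w
  ... | no a∉w  = no λ p → a∉w (↭.∈-resp-↭ p (here refl))
  ... | yes a∈w with ∈.∈-∃++ a∈w
  ... | w₁ , w₂ , refl = map′
          (λ p → ↭-trans (prep a p) (↭-sym (↭.shift a w₁ w₂)))
          (λ p → ↭.drop-∷ (↭-trans p (↭.shift a w₁ w₂)))
          (u ↭? w₁ ++ w₂)

  -- A polynomial is a formal sum of terms c·u; the terms need not be collected.
  Poly : Set
  Poly = List (ℤ × Monomial)

  coeff : Poly → Monomial → ℤ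
  coeff []            w = 0ℤ
  coeff ((c , u) ∷ p) w = (if does (u ↭? w) then c else 0ℤ) + coeff p w

  infix 4 _≈ₚ_
  record _≈ₚ_ (p q : Poly) : Set where
    constructor mk≈
    field coeff-≡ : ∀ w → coeff p w ≡ coeff q w
  open _≈ₚ_ public

  infixl 6 _+ₚ_
  infixl 7 _*ₚ_ _·ₚ_

  0ₚ 1ₚ : Poly
  0ₚ = []
  1ₚ = [ 1ℤ , [] ]

  const : ℤ → Poly
  const c = [ c , [] ]

  var : A → Poly
  var a = [ 1ℤ , [ a ] ]

  _+ₚ_ : Poly → Poly → Poly
  _+ₚ_ = _++_

  -ₚ_ : Poly → Poly
  -ₚ_ = map λ (c , u) → (- c , u)

  _·ₚ_ : ℤ × Monomial → Poly → Poly
  (c , u) ·ₚ q = map (λ (d , v) → (c * d , u ++ v)) q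

  _*ₚ_ : Poly → Poly → Poly
  p *ₚ q = concatMap (_·ₚ q) p

  evalMonomial : (A → Poly) → Monomial → Poly
  evalMonomial σ []      = 1ₚ
  evalMonomial σ (a ∷ u) = σ a *ₚ evalMonomial σ u

  substitute : (A → Poly) → Poly → Poly
  substitute σ = concatMap λ (c , u) → const c *ₚ evalMonomial σ u

  setZero : {Z : Pred A 0ℓ} → Decidable Z → Poly → Poly
  setZero Z? = substitute λ a → if does (Z? a) then 0ₚ else var a

  rename : (A → A) → Poly → Poly
  rename π = map λ (c , u) → (c , map π u)

  -- ⟪ p , g ⟫ is the value on p of the ℤ-linear extension of g.
  ⟪_,_⟫ : Poly → (Monomial → ℤ) → ℤ
  ⟪ [] , g ⟫            = 0ℤ
  ⟪ (c , u) ∷ p , g ⟫   = c * g u + ⟪ p , g ⟫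

  δ : Monomial → Monomial → ℤ
  δ w u = if does (u ↭? w) then 1ℤ else 0ℤ

  Invariant : (Monomial → ℤ) → Set
  Invariant g = ∀ {u v} → u ↭ v → g u ≡ g v

  δ-yes : ∀ {w u} → u ↭ w → δ w u ≡ 1ℤ
  δ-yes {w} {u} p rewrite dec-true (u ↭? w) p = refl

  δ-no : ∀ {w u} → ¬ (u ↭ w) → δ w u ≡ 0ℤ
  δ-no {w} {u} p rewrite dec-false (u ↭? w) p = refl

  δ-cong : ∀ w u w′ u′ → (u ↭ w → u′ ↭ w′) → (u′ ↭ w′ → u ↭ w) → δ w u ≡ δ w′ u′
  δ-cong w u w′ u′ f g with u ↭? w
  ... | yes p = sym (δ-yes (f p))
  ... | no ¬p = sym (δ-no (¬p ∘ g))

  δ-invariant : ∀ w → Invariant (δ w)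
  δ-invariant w {u} {v} p = δ-cong w u w v (↭-trans (↭-sym p)) (↭-trans p)

  coeff-⟪⟫ : ∀ p w → coeff p w ≡ ⟪ p , δ w ⟫
  coeff-⟪⟫ []            w = refl
  coeff-⟪⟫ ((c , u) ∷ p) w with does (u ↭? w)
  ... | true  = cong₂ _+_ (sym (ℤ.*-identityʳ c)) (coeff-⟪⟫ p w)
  ... | false = cong₂ _+_ (sym (ℤ.*-zeroʳ c)) (coeff-⟪⟫ p w)

  ⟪⟫-cong : ∀ p {g h} → (∀ u → g u ≡ h u) → ⟪ p , g ⟫ ≡ ⟪ p , h ⟫
  ⟪⟫-cong []            e = refl
  ⟪⟫-cong ((c , u) ∷ p) e = cong₂ _+_ (cong (c *_) (e u)) (⟪⟫-cong p e)

  ⟪⟫-zero : ∀ p → ⟪ p , (λ _ → 0ℤ) ⟫ ≡ 0ℤ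
  ⟪⟫-zero []            = refl
  ⟪⟫-zero ((c , u) ∷ p) = trans (cong₂ _+_ (ℤ.*-zeroʳ c) (⟪⟫-zero p)) refl

  private
    interchange : ∀ a b c d → (a + b) + (c + d) ≡ (a + c) + (b + d)
    interchange a b c d = begin
      (a + b) + (c + d)  ≡⟨ ℤ.+-assoc a b (c + d) ⟩
      a + (b + (c + d))  ≡⟨ cong (a +_) (ℤ.+-assoc b c d) ⟨
      a + ((b + c) + d)  ≡⟨ cong (λ x → a + (x + d)) (ℤ.+-comm b c) ⟩
      a + ((c + b) + d)  ≡⟨ cong (a +_) (ℤ.+-assoc c b d) ⟩
      a + (c + (b + d))  ≡⟨ ℤ.+-assoc a c (b + d) ⟨
      (a + c) + (b + d)  ∎
      where open ≡-Reasoning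

  ⟪⟫-+ : ∀ p g h → ⟪ p , (λ u → g u + h u) ⟫ ≡ ⟪ p , g ⟫ + ⟪ p , h ⟫
  ⟪⟫-+ []            g h = refl
  ⟪⟫-+ ((c , u) ∷ p) g h = trans
    (cong₂ _+_ (ℤ.*-distribˡ-+ c (g u) (h u)) (⟪⟫-+ p g h))
    (interchange (c * g u) (c * h u) ⟪ p , g ⟫ ⟪ p , h ⟫)

  ⟪⟫-++ : ∀ p q g → ⟪ p ++ q , g ⟫ ≡ ⟪ p , g ⟫ + ⟪ q , g ⟫
  ⟪⟫-++ []            q g = sym (ℤ.+-identityˡ _)
  ⟪⟫-++ ((c , u) ∷ p) q g =
    trans (cong (c * g u +_) (⟪⟫-++ p q g)) (sym (ℤ.+-assoc (c * g u) ⟪ p , g ⟫ ⟪ q , g ⟫))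

  ⟪⟫-neg : ∀ p g → ⟪ -ₚ p , g ⟫ ≡ - ⟪ p , g ⟫
  ⟪⟫-neg []            g = refl
  ⟪⟫-neg ((c , u) ∷ p) g = trans
    (cong₂ _+_ (sym (ℤ.neg-distribˡ-* c (g u))) (⟪⟫-neg p g))
    (sym (ℤ.neg-distrib-+ (c * g u) ⟪ p , g ⟫))

  ⟪⟫-· : ∀ c u q g → ⟪ (c , u) ·ₚ q , g ⟫ ≡ c * ⟪ q , (λ v → g (u ++ v)) ⟫
  ⟪⟫-· c u []            g = sym (ℤ.*-zeroʳ c)
  ⟪⟫-· c u ((d , v) ∷ q) g = trans
    (cong₂ _+_ (ℤ.*-assoc c d (g (u ++ v))) (⟪⟫-· c u q g))
    (sym (ℤ.*-distribˡ-+ c (d * g (u ++ v)) _))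

  ⟪⟫-* : ∀ p q g → ⟪ p *ₚ q , g ⟫ ≡ ⟪ p , (λ u → ⟪ q , (λ v → g (u ++ v)) ⟫) ⟫
  ⟪⟫-* []            q g = refl
  ⟪⟫-* ((c , u) ∷ p) q g = trans (⟪⟫-++ ((c , u) ·ₚ q) (p *ₚ q) g)
    (cong₂ _+_ (⟪⟫-· c u q g) (⟪⟫-* p q g))

  ⟪⟫-substitute : ∀ σ p g → ⟪ substitute σ p , g ⟫ ≡ ⟪ p , (λ u → ⟪ evalMonomial σ u , g ⟫) ⟫
  ⟪⟫-substitute σ []            g = refl
  ⟪⟫-substitute σ ((c , u) ∷ p) g = trans (⟪⟫-++ (const c *ₚ evalMonomial σ u) (substitute σ p) g)
    (cong₂ _+_
      (trans (cong (λ q → ⟪ q , g ⟫) (List.++-identityʳ ((c , []) ·ₚ evalMonomial σ u)))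
             (⟪⟫-· c [] (evalMonomial σ u) g))
      (⟪⟫-substitute σ p g))

  ⟪⟫-rename : ∀ π p g → ⟪ rename π p , g ⟫ ≡ ⟪ p , g ∘ map π ⟫
  ⟪⟫-rename π []            g = refl
  ⟪⟫-rename π ((c , u) ∷ p) g = cong (c * g (map π u) +_) (⟪⟫-rename π p g)

  -- Removes all terms whose monomial is u.
  private
    others : Monomial → Poly → Poly
    others u [] = []
    others u ((d , v) ∷ p) with v ↭? u
    ... | yes _ = others u p
    ... | no  _ = (d , v) ∷ others u p

    others-length : ∀ u p → length (others u p) ≤ length p
    others-length u [] = z≤n
    others-length u ((d , v) ∷ p) with v ↭? u
    ... | yes _ = ℕ.m≤n⇒m≤1+n (others-length u p)
    ... | no  _ = s≤s (others-length u p)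

    ⟪⟫-others : ∀ u p {g} → Invariant g → ⟪ p , g ⟫ ≡ coeff p u * g u + ⟪ others u p , g ⟫
    ⟪⟫-others u [] {g} inv = refl
    ⟪⟫-others u ((d , v) ∷ p) {g} inv with v ↭? u
    ... | yes v↭u = begin
      d * g v + ⟪ p , g ⟫                                  ≡⟨ cong₂ _+_ (cong (d *_) (inv v↭u)) (⟪⟫-others u p inv) ⟩
      d * g u + (coeff p u * g u + ⟪ others u p , g ⟫)     ≡⟨ ℤ.+-assoc (d * g u) (coeff p u * g u) _ ⟨
      (d * g u + coeff p u * g u) + ⟪ others u p , g ⟫     ≡⟨ cong (_+ ⟪ others u p , g ⟫) (ℤ.*-distribʳ-+ (g u) d (coeff p u)) ⟨
      (d + coeff p u) * g u + ⟪ others u p , g ⟫           ∎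
      where open ≡-Reasoning
    ... | no  _ = begin
      d * g v + ⟪ p , g ⟫                                  ≡⟨ cong (d * g v +_) (⟪⟫-others u p inv) ⟩
      d * g v + (coeff p u * g u + ⟪ others u p , g ⟫)     ≡⟨ ℤ.+-assoc (d * g v) (coeff p u * g u) _ ⟨
      (d * g v + coeff p u * g u) + ⟪ others u p , g ⟫     ≡⟨ cong (_+ ⟪ others u p , g ⟫) (ℤ.+-comm (d * g v) (coeff p u * g u)) ⟩
      (coeff p u * g u + d * g v) + ⟪ others u p , g ⟫     ≡⟨ ℤ.+-assoc (coeff p u * g u) (d * g v) _ ⟩
      coeff p u * g u + (d * g v + ⟪ others u p , g ⟫)     ≡⟨ cong (λ x → x * g u + (d * g v + ⟪ others u p , g ⟫)) (ℤ.+-identityˡ (coeff p u)) ⟨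
      (0ℤ + coeff p u) * g u + (d * g v + ⟪ others u p , g ⟫) ∎
      where open ≡-Reasoning

    coeff-others : ∀ u p w → coeff (others u p) w ≢ 0ℤ → coeff p w ≢ 0ℤ
    coeff-others u p w ≢0 e = ≢0 (case-↭ (w ↭? u))
      where
      split : coeff p w ≡ coeff p u * δ w u + coeff (others u p) w
      split = trans (coeff-⟪⟫ p w) (trans (⟪⟫-others u p (δ-invariant w))
                (cong (coeff p u * δ w u +_) (sym (coeff-⟪⟫ (others u p) w))))
      vanish : ∀ q → w ↭ u → coeff (others u q) w ≡ 0ℤ
      vanish [] w↭u = refl
      vanish ((d , v) ∷ q) w↭u with v ↭? u
      ... | yes _ = vanish q w↭u
      ... | no ¬v↭u rewrite dec-false (v ↭? w) (λ v↭w → ¬v↭u (↭-trans v↭w w↭u)) =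
              trans (ℤ.+-identityˡ _) (vanish q w↭u)
      case-↭ : Dec (w ↭ u) → coeff (others u p) w ≡ 0ℤ
      case-↭ (yes w↭u) = vanish p w↭u
      case-↭ (no ¬w↭u) = begin
        coeff (others u p) w                        ≡⟨ ℤ.+-identityˡ _ ⟨
        0ℤ + coeff (others u p) w                   ≡⟨ cong (_+ coeff (others u p) w) (ℤ.*-zeroʳ (coeff p u)) ⟨
        coeff p u * 0ℤ + coeff (others u p) w       ≡⟨ cong (λ x → coeff p u * x + coeff (others u p) w) (δ-no (¬w↭u ∘ ↭-sym)) ⟨
        coeff p u * δ w u + coeff (others u p) w    ≡⟨ split ⟨
        coeff p w                                   ≡⟨ e ⟩
        0ℤ                                          ∎
        where open ≡-Reasoning

    vanishing : ∀ n p {g} → length p ≤ n → Invariant g →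
                (∀ u → coeff p u ≢ 0ℤ → g u ≡ 0ℤ) → ⟪ p , g ⟫ ≡ 0ℤ
    vanishing n       []              l       inv h = refl
    vanishing (suc n) (t@(c , u) ∷ p) {g} (s≤s l) inv h = begin
      ⟪ t ∷ p , g ⟫                                          ≡⟨ ⟪⟫-others u (t ∷ p) inv ⟩
      coeff (t ∷ p) u * g u + ⟪ others u (t ∷ p) , g ⟫       ≡⟨ cong₂ _+_ head-zero tail-zero ⟩
      0ℤ                                                     ∎
      where
      open ≡-Reasoning
      head-zero : coeff (t ∷ p) u * g u ≡ 0ℤ
      head-zero with coeff (t ∷ p) u ℤ.≟ 0ℤ
      ... | yes e  = trans (cong (_* g u) e) (ℤ.*-zeroˡ (g u))
      ... | no  ≢0 = trans (cong (coeff (t ∷ p) u *_) (h u ≢0)) (ℤ.*-zeroʳ (coeff (t ∷ p) u))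
      shrink : length (others u (t ∷ p)) ≤ n
      shrink with u ↭? u
      ... | yes _  = ℕ.≤-trans (others-length u p) l
      ... | no ¬uu = contradiction ↭-refl ¬uu
      tail-zero : ⟪ others u (t ∷ p) , g ⟫ ≡ 0ℤ
      tail-zero = vanishing n (others u (t ∷ p)) shrink inv λ v ≢0 → h v (coeff-others u (t ∷ p) v ≢0)

  ⟪⟫-vanish : ∀ p {g} → Invariant g → (∀ u → coeff p u ≢ 0ℤ → g u ≡ 0ℤ) → ⟪ p , g ⟫ ≡ 0ℤ
  ⟪⟫-vanish p = vanishing (length p) p ℕ.≤-refl

  coeff-+ : ∀ p q w → coeff (p +ₚ q) w ≡ coeff p w + coeff q w
  coeff-+ p q w = trans (coeff-⟪⟫ (p +ₚ q) w) (trans (⟪⟫-++ p q (δ w))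
    (sym (cong₂ _+_ (coeff-⟪⟫ p w) (coeff-⟪⟫ q w))))

  coeff-neg : ∀ p w → coeff (-ₚ p) w ≡ - coeff p w
  coeff-neg p w = trans (coeff-⟪⟫ (-ₚ p) w) (trans (⟪⟫-neg p (δ w)) (cong -_ (sym (coeff-⟪⟫ p w))))

  ⟪⟫-resp : ∀ {p q} → p ≈ₚ q → ∀ {g} → Invariant g → ⟪ p , g ⟫ ≡ ⟪ q , g ⟫
  ⟪⟫-resp {p} {q} p≈q {g} inv = ℤ.i-j≡0⇒i≡j ⟪ p , g ⟫ ⟪ q , g ⟫ (begin
    ⟪ p , g ⟫ + - ⟪ q , g ⟫     ≡⟨ cong (⟪ p , g ⟫ +_) (⟪⟫-neg q g) ⟨
    ⟪ p , g ⟫ + ⟪ -ₚ q , g ⟫    ≡⟨ ⟪⟫-++ p (-ₚ q) g ⟨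
    ⟪ p +ₚ (-ₚ q) , g ⟫         ≡⟨ ⟪⟫-vanish (p +ₚ (-ₚ q)) inv (λ u ≢0 → contradiction (zero-at u) ≢0) ⟩
    0ℤ                          ∎)
    where
    open ≡-Reasoning
    zero-at : ∀ u → coeff (p +ₚ (-ₚ q)) u ≡ 0ℤ
    zero-at u = begin
      coeff (p +ₚ (-ₚ q)) u       ≡⟨ coeff-+ p (-ₚ q) u ⟩
      coeff p u + coeff (-ₚ q) u  ≡⟨ cong₂ _+_ (coeff-≡ p≈q u) (coeff-neg q u) ⟩
      coeff q u + - coeff q u     ≡⟨ ℤ.+-inverseʳ (coeff q u) ⟩
      0ℤ                          ∎

  coeff-resp-↭ : ∀ p {u v} → u ↭ v → coeff p u ≡ coeff p v
  coeff-resp-↭ p {u} {v} u↭v = begin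
    coeff p u     ≡⟨ coeff-⟪⟫ p u ⟩
    ⟪ p , δ u ⟫   ≡⟨ ⟪⟫-cong p (λ x → δ-cong u x v x (λ x↭u → ↭-trans x↭u u↭v) (λ x↭v → ↭-trans x↭v (↭-sym u↭v))) ⟩
    ⟪ p , δ v ⟫   ≡⟨ coeff-⟪⟫ p v ⟨
    coeff p v     ∎
    where open ≡-Reasoning

  ⟪⟫⇒≈ : ∀ {p q} → (∀ w → ⟪ p , δ w ⟫ ≡ ⟪ q , δ w ⟫) → p ≈ₚ q
  ⟪⟫⇒≈ {p} {q} e = mk≈ λ w → trans (coeff-⟪⟫ p w) (trans (e w) (sym (coeff-⟪⟫ q w)))

  ≈-refl : Reflexive _≈ₚ_
  ≈-refl = mk≈ λ _ → refl

  ≈-sym : Symmetric _≈ₚ_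
  ≈-sym e = mk≈ λ w → sym (coeff-≡ e w)

  ≈-trans : Transitive _≈ₚ_
  ≈-trans e f = mk≈ λ w → trans (coeff-≡ e w) (coeff-≡ f w)

  +ₚ-cong : ∀ {p p′ q q′} → p ≈ₚ p′ → q ≈ₚ q′ → p +ₚ q ≈ₚ p′ +ₚ q′
  +ₚ-cong {p} {p′} {q} {q′} e f = mk≈ λ w →
    trans (coeff-+ p q w) (trans (cong₂ _+_ (coeff-≡ e w) (coeff-≡ f w)) (sym (coeff-+ p′ q′ w)))

  +ₚ-assoc : ∀ p q r → (p +ₚ q) +ₚ r ≈ₚ p +ₚ (q +ₚ r)
  +ₚ-assoc p q r = mk≈ λ w → cong (λ x → coeff x w) (List.++-assoc p q r)

  +ₚ-comm : ∀ p q → p +ₚ q ≈ₚ q +ₚ p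
  +ₚ-comm p q = mk≈ λ w → trans (coeff-+ p q w) (trans (ℤ.+-comm (coeff p w) (coeff q w)) (sym (coeff-+ q p w)))

  +ₚ-identityʳ : ∀ p → p +ₚ 0ₚ ≈ₚ p
  +ₚ-identityʳ p = mk≈ λ w → cong (λ x → coeff x w) (List.++-identityʳ p)

  +ₚ-inverseʳ : ∀ p → p +ₚ (-ₚ p) ≈ₚ 0ₚ
  +ₚ-inverseʳ p = mk≈ λ w → trans (coeff-+ p (-ₚ p) w)
    (trans (cong (coeff p w +_) (coeff-neg p w)) (ℤ.+-inverseʳ (coeff p w)))

  -ₚ-cong : ∀ {p q} → p ≈ₚ q → -ₚ p ≈ₚ -ₚ q
  -ₚ-cong {p} {q} e = mk≈ λ w → trans (coeff-neg p w) (trans (cong -_ (coeff-≡ e w)) (sym (coeff-neg q w)))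

  private
    section-invariant : ∀ q {g} → Invariant g → Invariant (λ u → ⟪ q , (λ v → g (u ++ v)) ⟫)
    section-invariant q inv u↭u′ = ⟪⟫-cong q λ v → inv (↭.++⁺ʳ v u↭u′)

  *ₚ-cong : ∀ {p p′ q q′} → p ≈ₚ p′ → q ≈ₚ q′ → p *ₚ q ≈ₚ p′ *ₚ q′
  *ₚ-cong {p} {p′} {q} {q′} e f = ⟪⟫⇒≈ λ w → begin
    ⟪ p *ₚ q , δ w ⟫                                  ≡⟨ ⟪⟫-* p q (δ w) ⟩
    ⟪ p , (λ u → ⟪ q , (λ v → δ w (u ++ v)) ⟫) ⟫      ≡⟨ ⟪⟫-cong p (λ u → ⟪⟫-resp f (λ v↭v′ → δ-invariant w (↭.++⁺ˡ u v↭v′))) ⟩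
    ⟪ p , (λ u → ⟪ q′ , (λ v → δ w (u ++ v)) ⟫) ⟫     ≡⟨ ⟪⟫-resp e (section-invariant q′ (δ-invariant w)) ⟩
    ⟪ p′ , (λ u → ⟪ q′ , (λ v → δ w (u ++ v)) ⟫) ⟫    ≡⟨ ⟪⟫-* p′ q′ (δ w) ⟨
    ⟪ p′ *ₚ q′ , δ w ⟫                                ∎
    where open ≡-Reasoning

  *ₚ-assoc : ∀ p q r → (p *ₚ q) *ₚ r ≈ₚ p *ₚ (q *ₚ r)
  *ₚ-assoc p q r = ⟪⟫⇒≈ λ w → begin
    ⟪ (p *ₚ q) *ₚ r , δ w ⟫
      ≡⟨ ⟪⟫-* (p *ₚ q) r (δ w) ⟩
    ⟪ p *ₚ q , (λ u → ⟪ r , (λ x → δ w (u ++ x)) ⟫) ⟫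
      ≡⟨ ⟪⟫-* p q _ ⟩
    ⟪ p , (λ u → ⟪ q , (λ v → ⟪ r , (λ x → δ w ((u ++ v) ++ x)) ⟫) ⟫) ⟫
      ≡⟨ ⟪⟫-cong p (λ u → ⟪⟫-cong q λ v → ⟪⟫-cong r λ x → cong (δ w) (List.++-assoc u v x)) ⟩
    ⟪ p , (λ u → ⟪ q , (λ v → ⟪ r , (λ x → δ w (u ++ (v ++ x))) ⟫) ⟫) ⟫
      ≡⟨ ⟪⟫-cong p (λ u → ⟪⟫-* q r _) ⟨
    ⟪ p , (λ u → ⟪ q *ₚ r , (λ v → δ w (u ++ v)) ⟫) ⟫
      ≡⟨ ⟪⟫-* p (q *ₚ r) (δ w) ⟨
    ⟪ p *ₚ (q *ₚ r) , δ w ⟫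
      ∎
    where open ≡-Reasoning

  *ₚ-identityˡ : ∀ p → 1ₚ *ₚ p ≈ₚ p
  *ₚ-identityˡ p = ⟪⟫⇒≈ λ w →
    trans (⟪⟫-* 1ₚ p (δ w)) (trans (ℤ.+-identityʳ _) (ℤ.*-identityˡ _))

  *ₚ-identityʳ : ∀ p → p *ₚ 1ₚ ≈ₚ p
  *ₚ-identityʳ p = ⟪⟫⇒≈ λ w → trans (⟪⟫-* p 1ₚ (δ w)) (⟪⟫-cong p λ u →
    trans (ℤ.+-identityʳ _) (trans (ℤ.*-identityˡ _) (cong (δ w) (List.++-identityʳ u))))

  *ₚ-distribˡ : ∀ p q r → p *ₚ (q +ₚ r) ≈ₚ p *ₚ q +ₚ p *ₚ r
  *ₚ-distribˡ p q r = ⟪⟫⇒≈ λ w → begin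
    ⟪ p *ₚ (q +ₚ r) , δ w ⟫
      ≡⟨ ⟪⟫-* p (q +ₚ r) (δ w) ⟩
    ⟪ p , (λ u → ⟪ q +ₚ r , (λ v → δ w (u ++ v)) ⟫) ⟫
      ≡⟨ ⟪⟫-cong p (λ u → ⟪⟫-++ q r _) ⟩
    ⟪ p , (λ u → ⟪ q , (λ v → δ w (u ++ v)) ⟫ + ⟪ r , (λ v → δ w (u ++ v)) ⟫) ⟫
      ≡⟨ ⟪⟫-+ p _ _ ⟩
    ⟪ p , (λ u → ⟪ q , (λ v → δ w (u ++ v)) ⟫) ⟫ + ⟪ p , (λ u → ⟪ r , (λ v → δ w (u ++ v)) ⟫) ⟫
      ≡⟨ cong₂ _+_ (⟪⟫-* p q (δ w)) (⟪⟫-* p r (δ w)) ⟨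
    ⟪ p *ₚ q , δ w ⟫ + ⟪ p *ₚ r , δ w ⟫
      ≡⟨ ⟪⟫-++ (p *ₚ q) (p *ₚ r) (δ w) ⟨
    ⟪ p *ₚ q +ₚ p *ₚ r , δ w ⟫
      ∎
    where open ≡-Reasoning

  *ₚ-distribʳ : ∀ p q r → (q +ₚ r) *ₚ p ≈ₚ q *ₚ p +ₚ r *ₚ p
  *ₚ-distribʳ p q r = ⟪⟫⇒≈ λ w → begin
    ⟪ (q +ₚ r) *ₚ p , δ w ⟫                ≡⟨ ⟪⟫-* (q +ₚ r) p (δ w) ⟩
    ⟪ q +ₚ r , _ ⟫                         ≡⟨ ⟪⟫-++ q r _ ⟩
    ⟪ q , _ ⟫ + ⟪ r , _ ⟫                  ≡⟨ cong₂ _+_ (⟪⟫-* q p (δ w)) (⟪⟫-* r p (δ w)) ⟨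
    ⟪ q *ₚ p , δ w ⟫ + ⟪ r *ₚ p , δ w ⟫    ≡⟨ ⟪⟫-++ (q *ₚ p) (r *ₚ p) (δ w) ⟨
    ⟪ q *ₚ p +ₚ r *ₚ p , δ w ⟫             ∎
    where open ≡-Reasoning

  *ₚ-support : ∀ {P : Pred Monomial 0ℓ} → Decidable P → (∀ {u v} → u ↭ v → P u → P v) →
               ∀ p q → (∀ u v → coeff p u ≢ 0ℤ → coeff q v ≢ 0ℤ → P (u ++ v)) →
               ∀ w → coeff (p *ₚ q) w ≢ 0ℤ → P w
  *ₚ-support {P} P? P-resp p q h w ≢0 = decidable-stable (P? w) λ ¬Pw → ≢0 (begin
    coeff (p *ₚ q) w      ≡⟨ coeff-⟪⟫ (p *ₚ q) w ⟩
    ⟪ p *ₚ q , δ w ⟫      ≡⟨ ⟪⟫-* p q (δ w) ⟩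
    ⟪ p , _ ⟫             ≡⟨ ⟪⟫-vanish p (section-invariant q (δ-invariant w)) (λ u ≢0ᵤ →
                              ⟪⟫-vanish q (λ v↭v′ → δ-invariant w (↭.++⁺ˡ u v↭v′)) λ v ≢0ᵥ →
                                δ-no λ uv↭w → ¬Pw (P-resp uv↭w (h u v ≢0ᵤ ≢0ᵥ))) ⟩
    0ℤ                    ∎)
    where open ≡-Reasoning

  module _ (π : A ↔ A) where
    open Inverse π

    private
      to-↭ : ∀ {u w} → map to u ↭ w → u ↭ map from w
      to-↭ {u} {w} p = subst (_↭ map from w)
        (trans (sym (List.map-∘ u)) (trans (List.map-cong strictlyInverseʳ u) (List.map-id u)))
        (↭.map⁺ from p)

      from-↭ : ∀ {u w} → u ↭ map from w → map to u ↭ w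
      from-↭ {u} {w} p = subst (map to u ↭_)
        (trans (sym (List.map-∘ w)) (trans (List.map-cong strictlyInverseˡ w) (List.map-id w)))
        (↭.map⁺ to p)

    coeff-rename : ∀ p w → coeff (rename to p) w ≡ coeff p (map from w)
    coeff-rename p w = begin
      coeff (rename to p) w      ≡⟨ coeff-⟪⟫ (rename to p) w ⟩
      ⟪ rename to p , δ w ⟫      ≡⟨ ⟪⟫-rename to p (δ w) ⟩
      ⟪ p , δ w ∘ map to ⟫       ≡⟨ ⟪⟫-cong p (λ u → δ-cong w (map to u) (map from w) u to-↭ from-↭) ⟩
      ⟪ p , δ (map from w) ⟫     ≡⟨ coeff-⟪⟫ p (map from w) ⟨
      coeff p (map from w)       ∎
      where open ≡-Reasoning

  rename-* : ∀ π p q → rename π (p *ₚ q) ≈ₚ rename π p *ₚ rename π q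
  rename-* π p q = ⟪⟫⇒≈ λ w → begin
    ⟪ rename π (p *ₚ q) , δ w ⟫
      ≡⟨ ⟪⟫-rename π (p *ₚ q) (δ w) ⟩
    ⟪ p *ₚ q , δ w ∘ map π ⟫
      ≡⟨ ⟪⟫-* p q _ ⟩
    ⟪ p , (λ u → ⟪ q , (λ v → δ w (map π (u ++ v))) ⟫) ⟫
      ≡⟨ ⟪⟫-cong p (λ u → ⟪⟫-cong q λ v → cong (δ w) (List.map-++ π u v)) ⟩
    ⟪ p , (λ u → ⟪ q , (λ v → δ w (map π u ++ map π v)) ⟫) ⟫
      ≡⟨ ⟪⟫-cong p (λ u → ⟪⟫-rename π q _) ⟨
    ⟪ p , (λ u → ⟪ rename π q , (λ v → δ w (map π u ++ v)) ⟫) ⟫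
      ≡⟨ ⟪⟫-rename π p _ ⟨
    ⟪ rename π p , (λ u → ⟪ rename π q , (λ v → δ w (u ++ v)) ⟫) ⟫
      ≡⟨ ⟪⟫-* (rename π p) (rename π q) (δ w) ⟨
    ⟪ rename π p *ₚ rename π q , δ w ⟫
      ∎
    where open ≡-Reasoning

  module _ {Z : Pred A 0ℓ} (Z? : Decidable Z) where

    private
      σ : A → Poly
      σ a = if does (Z? a) then 0ₚ else var a

    eval-alive : ∀ {u} → All (¬_ ∘ Z) u → ∀ g → ⟪ evalMonomial σ u , g ⟫ ≡ g u
    eval-alive [] g = trans (ℤ.+-identityʳ _) (ℤ.*-identityˡ _)
    eval-alive {a ∷ u} (¬Za ∷ alive) g rewrite dec-false (Z? a) ¬Za = begin
      ⟪ var a *ₚ evalMonomial σ u , g ⟫                            ≡⟨ ⟪⟫-* (var a) (evalMonomial σ u) g ⟩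
      1ℤ * ⟪ evalMonomial σ u , (λ v → g (a ∷ v)) ⟫ + 0ℤ           ≡⟨ ℤ.+-identityʳ _ ⟩
      1ℤ * ⟪ evalMonomial σ u , (λ v → g (a ∷ v)) ⟫                ≡⟨ ℤ.*-identityˡ _ ⟩
      ⟪ evalMonomial σ u , (λ v → g (a ∷ v)) ⟫                     ≡⟨ eval-alive alive (λ v → g (a ∷ v)) ⟩
      g (a ∷ u)                                                    ∎
      where open ≡-Reasoning

    eval-dead : ∀ {u} → Any Z u → ∀ g → ⟪ evalMonomial σ u , g ⟫ ≡ 0ℤ
    eval-dead {a ∷ u} dead g with Z? a
    ... | yes _ = refl
    ... | no ¬Za with dead
    ...   | here Za     = contradiction Za ¬Za
    ...   | there dead′ = begin
      ⟪ var a *ₚ evalMonomial σ u , g ⟫                            ≡⟨ ⟪⟫-* (var a) (evalMonomial σ u) g ⟩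
      1ℤ * ⟪ evalMonomial σ u , (λ v → g (a ∷ v)) ⟫ + 0ℤ           ≡⟨ cong (λ x → 1ℤ * x + 0ℤ) (eval-dead dead′ (λ v → g (a ∷ v))) ⟩
      0ℤ                                                           ∎
      where open ≡-Reasoning

    alive? : ∀ u → All (¬_ ∘ Z) u ⊎ Any Z u
    alive? u with any? Z? u
    ... | yes dead = inj₂ dead
    ... | no ¬dead = inj₁ (All.¬Any⇒All¬ u ¬dead)

    coeff-setZero-alive : ∀ p {w} → All (¬_ ∘ Z) w → coeff (setZero Z? p) w ≡ coeff p w
    coeff-setZero-alive p {w} alive = begin
      coeff (setZero Z? p) w                          ≡⟨ coeff-⟪⟫ (setZero Z? p) w ⟩
      ⟪ setZero Z? p , δ w ⟫                          ≡⟨ ⟪⟫-substitute σ p (δ w) ⟩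
      ⟪ p , (λ u → ⟪ evalMonomial σ u , δ w ⟫) ⟫      ≡⟨ ⟪⟫-cong p pointwise ⟩
      ⟪ p , δ w ⟫                                     ≡⟨ coeff-⟪⟫ p w ⟨
      coeff p w                                       ∎
      where
      open ≡-Reasoning
      pointwise : ∀ u → ⟪ evalMonomial σ u , δ w ⟫ ≡ δ w u
      pointwise u with alive? u
      ... | inj₁ aliveᵤ = eval-alive aliveᵤ (δ w)
      ... | inj₂ deadᵤ  = trans (eval-dead deadᵤ (δ w))
              (sym (δ-no λ u↭w → All.All¬⇒¬Any alive (↭.Any-resp-↭ u↭w deadᵤ)))

    coeff-setZero-dead : ∀ p {w} → Any Z w → coeff (setZero Z? p) w ≡ 0ℤ
    coeff-setZero-dead p {w} dead = begin
      coeff (setZero Z? p) w                          ≡⟨ coeff-⟪⟫ (setZero Z? p) w ⟩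
      ⟪ setZero Z? p , δ w ⟫                          ≡⟨ ⟪⟫-substitute σ p (δ w) ⟩
      ⟪ p , (λ u → ⟪ evalMonomial σ u , δ w ⟫) ⟫      ≡⟨ ⟪⟫-cong p pointwise ⟩
      ⟪ p , (λ _ → 0ℤ) ⟫                              ≡⟨ ⟪⟫-zero p ⟩
      0ℤ                                              ∎
      where
      open ≡-Reasoning
      pointwise : ∀ u → ⟪ evalMonomial σ u , δ w ⟫ ≡ 0ℤ
      pointwise u with alive? u
      ... | inj₂ deadᵤ  = eval-dead deadᵤ (δ w)
      ... | inj₁ aliveᵤ = trans (eval-alive aliveᵤ (δ w))
              (δ-no λ u↭w → All.All¬⇒¬Any aliveᵤ (↭.Any-resp-↭ (↭-sym u↭w) dead))

    setZero-* : ∀ p q → setZero Z? (p *ₚ q) ≈ₚ setZero Z? p *ₚ setZero Z? q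
    setZero-* p q = ⟪⟫⇒≈ λ w → begin
      ⟪ setZero Z? (p *ₚ q) , δ w ⟫
        ≡⟨ ⟪⟫-substitute σ (p *ₚ q) (δ w) ⟩
      ⟪ p *ₚ q , (λ u → ⟪ evalMonomial σ u , δ w ⟫) ⟫
        ≡⟨ ⟪⟫-* p q _ ⟩
      ⟪ p , (λ u → ⟪ q , (λ v → ⟪ evalMonomial σ (u ++ v) , δ w ⟫) ⟫) ⟫
        ≡⟨ ⟪⟫-cong p (pointwise w) ⟩
      ⟪ p , (λ u → ⟪ evalMonomial σ u , (λ u′ → ⟪ setZero Z? q , (λ v → δ w (u′ ++ v)) ⟫) ⟫) ⟫
        ≡⟨ ⟪⟫-substitute σ p _ ⟨
      ⟪ setZero Z? p , (λ u → ⟪ setZero Z? q , (λ v → δ w (u ++ v)) ⟫) ⟫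
        ≡⟨ ⟪⟫-* (setZero Z? p) (setZero Z? q) (δ w) ⟨
      ⟪ setZero Z? p *ₚ setZero Z? q , δ w ⟫
        ∎
      where
      open ≡-Reasoning
      pointwise : ∀ w u → ⟪ q , (λ v → ⟪ evalMonomial σ (u ++ v) , δ w ⟫) ⟫
                ≡ ⟪ evalMonomial σ u , (λ u′ → ⟪ setZero Z? q , (λ v → δ w (u′ ++ v)) ⟫) ⟫
      pointwise w u with alive? u
      ... | inj₂ dead  = trans (trans (⟪⟫-cong q λ v → eval-dead (Any.++⁺ˡ dead) (δ w)) (⟪⟫-zero q))
                               (sym (eval-dead dead _))
      ... | inj₁ alive = begin
        ⟪ q , (λ v → ⟪ evalMonomial σ (u ++ v) , δ w ⟫) ⟫
          ≡⟨ ⟪⟫-cong q inner ⟩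
        ⟪ q , (λ v → ⟪ evalMonomial σ v , (λ v′ → δ w (u ++ v′)) ⟫) ⟫
          ≡⟨ ⟪⟫-substitute σ q _ ⟨
        ⟪ setZero Z? q , (λ v → δ w (u ++ v)) ⟫
          ≡⟨ eval-alive alive _ ⟨
        ⟪ evalMonomial σ u , (λ u′ → ⟪ setZero Z? q , (λ v → δ w (u′ ++ v)) ⟫) ⟫
          ∎
        where
        inner : ∀ v → ⟪ evalMonomial σ (u ++ v) , δ w ⟫ ≡ ⟪ evalMonomial σ v , (λ v′ → δ w (u ++ v′)) ⟫
        inner v with alive? v
        ... | inj₁ aliveᵥ = trans (eval-alive (All.++⁺ alive aliveᵥ) (δ w)) (sym (eval-alive aliveᵥ _))
        ... | inj₂ deadᵥ  = trans (eval-dead (Any.++⁺ʳ u deadᵥ) (δ w)) (sym (eval-dead deadᵥ _))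

-- A graded ring is given by its homogeneous components; its underlying ring is the direct sum ⨁ below.
record GradedRing : Set₁ where
  infix  4 _≈_
  infixl 6 _⊞_
  infixl 7 _⊠_
  infix  8 ⊟_
  field
    Carrier           : ℕ → Set
    _≈_               : ∀ {r} → Rel (Carrier r) 0ℓ
    _⊞_               : ∀ {r} → Carrier r → Carrier r → Carrier r
    0#                : ∀ {r} → Carrier r
    ⊟_                : ∀ {r} → Carrier r → Carrier r
    _⊠_               : ∀ {r s} → Carrier r → Carrier s → Carrier (r ℕ.+ s)
    1#                : Carrier 0
    ⊞-isAbelianGroup  : ∀ r → IsAbelianGroup (_≈_ {r}) _⊞_ 0# ⊟_
    ⊠-cong            : ∀ {r s} {x x′ : Carrier r} {y y′ : Carrier s} → x ≈ x′ → y ≈ y′ → x ⊠ y ≈ x′ ⊠ y′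
    ⊠-assoc           : ∀ {r s t} (x : Carrier r) (y : Carrier s) (z : Carrier t) →
                        subst Carrier (ℕ.+-assoc r s t) ((x ⊠ y) ⊠ z) ≈ x ⊠ (y ⊠ z)
    ⊠-identityˡ       : ∀ {r} (x : Carrier r) → 1# ⊠ x ≈ x
    ⊠-identityʳ       : ∀ {r} (x : Carrier r) → subst Carrier (ℕ.+-identityʳ r) (x ⊠ 1#) ≈ x
    ⊠-distribˡ        : ∀ {r s} (x : Carrier r) (y z : Carrier s) → x ⊠ (y ⊞ z) ≈ x ⊠ y ⊞ x ⊠ z
    ⊠-distribʳ        : ∀ {r s} (x : Carrier s) (y z : Carrier r) → (y ⊞ z) ⊠ x ≈ y ⊠ x ⊞ z ⊠ x

  abelianGroup : ℕ → AbelianGroup 0ℓ 0ℓ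
  abelianGroup r = record { isAbelianGroup = ⊞-isAbelianGroup r }

  rawGroup : ℕ → RawGroup 0ℓ 0ℓ
  rawGroup r = AbelianGroup.rawGroup (abelianGroup r)

  module _ {r : ℕ} where
    open IsAbelianGroup (⊞-isAbelianGroup r) public
      using ()
      renaming ( refl to ≈-refl; sym to ≈-sym; trans to ≈-trans; ∙-cong to ⊞-cong; ⁻¹-cong to ⊟-cong
               ; assoc to ⊞-assoc; identity to ⊞-identity; inverse to ⊞-inverse; comm to ⊞-comm )

  record ⨁ : Set where
    field
      component : ∀ r → Carrier r
      finite    : ∃ λ N → ∀ r → N ≤ r → component r ≈ 0#

  _≈⨁_ : Rel ⨁ 0ℓ
  x ≈⨁ y = ∀ r → ⨁.component x r ≈ ⨁.component y r

record IsGradedRingHomomorphism (A B : GradedRing)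
       (f : ∀ {r} → GradedRing.Carrier A r → GradedRing.Carrier B r) : Set where
  private
    module A = GradedRing A
    module B = GradedRing B
  field
    isGroupHomomorphism : ∀ r → IsGroupHomomorphism (A.rawGroup r) (B.rawGroup r) (f {r})
    ⊠-homo              : ∀ {r s} (x : A.Carrier r) (y : A.Carrier s) → f (x A.⊠ y) B.≈ f x B.⊠ f y
    1#-homo             : f A.1# B.≈ B.1#

  module _ {r : ℕ} where
    open IsGroupHomomorphism (isGroupHomomorphism r) public
      using ()
      renaming (⟦⟧-cong to f-cong; homo to ⊞-homo; ε-homo to 0#-homo; ⁻¹-homo to ⊟-homo)

  total : A.⨁ → B.⨁
  total x = record
    { component = λ r → f (component r)
    ; finite    = let (N , zero-from) = finite in
                  N , λ r N≤r → B.≈-trans (f-cong (zero-from r N≤r)) 0#-homo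
    }
    where open A.⨁ x

IsSurjectiveHomomorphism : (A B : GradedRing) →
  (∀ {r} → GradedRing.Carrier A r → GradedRing.Carrier B r) → Set
IsSurjectiveHomomorphism A B f = Σ (IsGradedRingHomomorphism A B f) λ f-isHom →
  Surjective (GradedRing._≈⨁_ A) (GradedRing._≈⨁_ B) (IsGradedRingHomomorphism.total f-isHom)

record Hom (A B : GradedRing) : Set where
  field
    ⟦_⟧            : ∀ {r} → GradedRing.Carrier A r → GradedRing.Carrier B r
    isHomomorphism : IsGradedRingHomomorphism A B ⟦_⟧

  open IsGradedRingHomomorphism isHomomorphism public

open Hom public using (⟦_⟧)

infix 4 _≈ₕ_
_≈ₕ_ : {A B : GradedRing} → Rel (Hom A B) 0ℓ
_≈ₕ_ {A} {B} f g = ∀ {r} (x : GradedRing.Carrier A r) → GradedRing._≈_ B (⟦ f ⟧ x) (⟦ g ⟧ x)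

idₕ : ∀ A → Hom A A
idₕ A = record
  { ⟦_⟧ = id
  ; isHomomorphism = record
    { isGroupHomomorphism = λ r → Identity.isGroupHomomorphism (A.rawGroup r) A.≈-refl
    ; ⊠-homo              = λ _ _ → A.≈-refl
    ; 1#-homo             = A.≈-refl
    }
  }
  where module A = GradedRing A

infixr 9 _∘ₕ_
_∘ₕ_ : ∀ {A B C} → Hom B C → Hom A B → Hom A C
_∘ₕ_ {A} {B} {C} g f = record
  { ⟦_⟧ = λ x → ⟦ g ⟧ (⟦ f ⟧ x)
  ; isHomomorphism = record
    { isGroupHomomorphism = λ r → Composition.isGroupHomomorphism C.≈-trans
                                    (f.isGroupHomomorphism r) (g.isGroupHomomorphism r)
    ; ⊠-homo              = λ x y → C.≈-trans (g.f-cong (f.⊠-homo x y)) (g.⊠-homo (⟦ f ⟧ x) (⟦ f ⟧ y))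
    ; 1#-homo             = C.≈-trans (g.f-cong f.1#-homo) g.1#-homo
    }
  }
  where
  module C = GradedRing C
  module f = Hom f
  module g = Hom g

record Iso (A B : GradedRing) : Set where
  field
    to       : Hom A B
    from     : Hom B A
    to∘from  : to ∘ₕ from ≈ₕ idₕ B
    from∘to  : from ∘ₕ to ≈ₕ idₕ A

-- The limit, in the category of graded rings, of a diagram with an arrow A j → A i for each i ⋖ j.
module Limits {I : Set} (_⋖_ : Rel I 0ℓ) (A : I → GradedRing) (f : ∀ {i j} → i ⋖ j → Hom (A j) (A i)) where

  private module A i = GradedRing (A i)

  record Compatible (r : ℕ) : Set where
    field
      at         : ∀ i → A.Carrier i r
      compatible : ∀ {i j} (i⋖j : i ⋖ j) → A._≈_ i (⟦ f i⋖j ⟧ (at j)) (at i)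
  open Compatible public

  Limit : GradedRing
  Limit = record
    { Carrier = Compatible
    ; _≈_ = λ x y → ∀ i → A._≈_ i (at x i) (at y i)
    ; _⊞_ = λ x y → record
        { at = λ i → A._⊞_ i (at x i) (at y i)
        ; compatible = λ {i} {j} a → A.≈-trans i (Hom.⊞-homo (f a) (at x j) (at y j))
            (A.⊞-cong i (compatible x a) (compatible y a)) }
    ; 0# = record { at = λ i → A.0# i ; compatible = λ a → Hom.0#-homo (f a) }
    ; ⊟_ = λ x → record
        { at = λ i → A.⊟_ i (at x i)
        ; compatible = λ {i} {j} a → A.≈-trans i (Hom.⊟-homo (f a) (at x j)) (A.⊟-cong i (compatible x a)) }
    ; _⊠_ = λ x y → record
        { at = λ i → A._⊠_ i (at x i) (at y i)
        ; compatible = λ {i} {j} a → A.≈-trans i (Hom.⊠-homo (f a) (at x j) (at y j))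
            (A.⊠-cong i (compatible x a) (compatible y a)) }
    ; 1# = record { at = λ i → A.1# i ; compatible = λ a → Hom.1#-homo (f a) }
    ; ⊞-isAbelianGroup = λ r → record
        { isGroup = record
          { isMonoid = record
            { isSemigroup = record
              { isMagma = record
                { isEquivalence = record
                  { refl = λ i → A.≈-refl i ; sym = λ e i → A.≈-sym i (e i)
                  ; trans = λ d e i → A.≈-trans i (d i) (e i) }
                ; ∙-cong = λ d e i → A.⊞-cong i (d i) (e i) }
              ; assoc = λ x y z i → A.⊞-assoc i (at x i) (at y i) (at z i) }
            ; identity = (λ x i → proj₁ (A.⊞-identity i) (at x i)) , (λ x i → proj₂ (A.⊞-identity i) (at x i)) }
          ; inverse = (λ x i → proj₁ (A.⊞-inverse i) (at x i)) , (λ x i → proj₂ (A.⊞-inverse i) (at x i))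
          ; ⁻¹-cong = λ e i → A.⊟-cong i (e i) }
        ; comm = λ x y i → A.⊞-comm i (at x i) (at y i) }
    ; ⊠-cong = λ d e i → A.⊠-cong i (d i) (e i)
    ; ⊠-assoc = λ {r} {s} {t} x y z i → at-subst (ℕ.+-assoc r s t) _ i (A.⊠-assoc i (at x i) (at y i) (at z i))
    ; ⊠-identityˡ = λ x i → A.⊠-identityˡ i (at x i)
    ; ⊠-identityʳ = λ {r} x i → at-subst (ℕ.+-identityʳ r) _ i (A.⊠-identityʳ i (at x i))
    ; ⊠-distribˡ = λ x y z i → A.⊠-distribˡ i (at x i) (at y i) (at z i)
    ; ⊠-distribʳ = λ x y z i → A.⊠-distribʳ i (at x i) (at y i) (at z i)
    }
    where
    at-subst : ∀ {r s} (e : r ≡ s) (x : Compatible r) i {y : A.Carrier i s} →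
               A._≈_ i (subst (A.Carrier i) e (at x i)) y → A._≈_ i (at (subst Compatible e x) i) y
    at-subst refl x i p = p

  proj : ∀ i → Hom Limit (A i)
  proj i = record
    { ⟦_⟧ = λ x → at x i
    ; isHomomorphism = record
      { isGroupHomomorphism = λ r → record
        { isMonoidHomomorphism = record
          { isMagmaHomomorphism = record
            { isRelHomomorphism = record { cong = λ e → e i } ; homo = λ _ _ → A.≈-refl i }
          ; ε-homo = A.≈-refl i }
        ; ⁻¹-homo = λ _ → A.≈-refl i }
      ; ⊠-homo  = λ _ _ → A.≈-refl i
      ; 1#-homo = A.≈-refl i
      }
    }

  lift : ∀ {B} (g : ∀ i → Hom B (A i)) → (∀ {i j} (a : i ⋖ j) → f a ∘ₕ g j ≈ₕ g i) → Hom B Limit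
  lift g cone = record
    { ⟦_⟧ = λ x → record { at = λ i → ⟦ g i ⟧ x ; compatible = λ a → cone a x }
    ; isHomomorphism = record
      { isGroupHomomorphism = λ r → record
        { isMonoidHomomorphism = record
          { isMagmaHomomorphism = record
            { isRelHomomorphism = record { cong = λ e i → Hom.f-cong (g i) e }
            ; homo = λ x y i → Hom.⊞-homo (g i) x y }
          ; ε-homo = λ i → Hom.0#-homo (g i) }
        ; ⁻¹-homo = λ x i → Hom.⊟-homo (g i) x }
      ; ⊠-homo  = λ x y i → Hom.⊠-homo (g i) x y
      ; 1#-homo = λ i → Hom.1#-homo (g i)
      }
    }

open Limits using (Limit; proj; lift)

-- The limit of ⋯ → A 2 → A 1 → A 0.
_⋖_ : Rel ℕ 0ℓ
i ⋖ j = suc i ≡ j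

module Sequence (A : ℕ → GradedRing) (f : ∀ i → Hom (A (suc i)) (A i)) where

  step : ∀ {i j} → i ⋖ j → Hom (A j) (A i)
  step {i} refl = f i

  SequentialLimit : GradedRing
  SequentialLimit = Limit _⋖_ A step

  -- composite i j = f i ∘ f (i + 1) ∘ ⋯ ∘ f (j - 1)
  composite′ : ∀ {i j} → i ≤′ j → Hom (A j) (A i)
  composite′ {i} (≤′-reflexive refl) = idₕ (A i)
  composite′ (≤′-step {n = j} i≤j)   = composite′ i≤j ∘ₕ f j

  composite : ∀ {i j} → i ≤ j → Hom (A j) (A i)
  composite i≤j = composite′ (ℕ.≤⇒≤′ i≤j)

  seqProj : ∀ i → Hom SequentialLimit (A i)
  seqProj = proj _⋖_ A step

  seqLift : ∀ {B} (g : ∀ i → Hom B (A i)) → (∀ i → f i ∘ₕ g (suc i) ≈ₕ g i) → Hom B SequentialLimit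
  seqLift {B} g cone = lift _⋖_ A step g cone′
    where
    cone′ : ∀ {i j} (i⋖j : i ⋖ j) → step i⋖j ∘ₕ g j ≈ₕ g i
    cone′ refl = cone _

open Sequence using (SequentialLimit; composite; seqProj; seqLift)

seqMap : ∀ {A f B g} (t : ∀ i → Hom (A i) (B i)) → (∀ i → g i ∘ₕ t (suc i) ≈ₕ t i ∘ₕ f i) →
         Hom (SequentialLimit A f) (SequentialLimit B g)
seqMap {A} {f} {B} {g} t square = seqLift B g (λ i → t i ∘ₕ seqProj A f i) λ i x →
  GradedRing.≈-trans (B i) (square i (Limits.at x (suc i))) (Hom.f-cong (t i) (Limits.compatible x refl))

record DirectedSet : Set₁ where
  infix 4 _⊑_
  field
    Carrier    : Set
    _⊑_        : Rel Carrier 0ℓ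
    isPreorder : IsPreorder _≡_ _⊑_
    directed   : ∀ i j → ∃ λ l → i ⊑ l × j ⊑ l

module _ (I : DirectedSet) where

  open DirectedSet I

  record IsDirectedFamily (A : Carrier → GradedRing) (f : ∀ {i j} → i ⊑ j → Hom (A j) (A i)) : Set where
    field
      identity    : ∀ {i} (i⊑i : i ⊑ i) → f i⊑i ≈ₕ idₕ (A i)
      composition : ∀ {i j l} (i⊑j : i ⊑ j) (j⊑l : j ⊑ l) (i⊑l : i ⊑ l) → f i⊑j ∘ₕ f j⊑l ≈ₕ f i⊑l

  InverseLimit : (A : Carrier → GradedRing) → (∀ {i j} → i ⊑ j → Hom (A j) (A i)) → GradedRing
  InverseLimit = Limit _⊑_

ℕ-directed : DirectedSet
ℕ-directed = record
  { Carrier = ℕ ; _⊑_ = _≤_ ; isPreorder = ℕ.≤-isPreorder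
  ; directed = λ i j → i ℕ.⊔ j , ℕ.m≤m⊔n i j , ℕ.m≤n⊔m i j }

ℕ⁺-directed : DirectedSet
ℕ⁺-directed = record
  { Carrier = ∃ λ m → 1 ≤ m
  ; _⊑_ = λ i j → proj₁ i ≤ proj₁ j
  ; isPreorder = record { isEquivalence = isEquivalence ; reflexive = λ { refl → ℕ.≤-refl } ; trans = ℕ.≤-trans }
  ; directed = λ (i , 1≤i) (j , _) → (i ℕ.⊔ j , ℕ.≤-trans 1≤i (ℕ.m≤m⊔n i j)) , ℕ.m≤m⊔n i j , ℕ.m≤n⊔m i j }

module Symmetric {A : Set} (_≟_ : DecidableEquality A) where

  open Polynomial _≟_ public
  open import Data.List.Membership.DecPropositional _≟_ using (_∈?_)

  -- Homogeneous symmetric polynomials of degree r in the finitely many indeterminates listed in F.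
  -- The permutations of F are the permutations of A that fix everything outside F.
  record Sym (F : List A) (r : ℕ) : Set where
    field
      poly        : Poly
      supported   : ∀ w → coeff poly w ≢ 0ℤ → All (_∈ F) w
      homogeneous : ∀ w → coeff poly w ≢ 0ℤ → length w ≡ r
      symmetric   : ∀ (π : A ↔ A) → (∀ {a} → a ∉ F → Inverse.to π a ≡ a) → rename (Inverse.to π) poly ≈ₚ poly
  open Sym public

  private
    stable : ∀ {P : Set} {c d : ℤ} → c ≡ d → (d ≢ 0ℤ → P) → c ≢ 0ℤ → P
    stable refl h = h

    +-support : ∀ {P : Set} → Dec P → ∀ c d → (c ≢ 0ℤ → P) → (d ≢ 0ℤ → P) → c + d ≢ 0ℤ → P
    +-support P? c d hc hd ≢0 with c ℤ.≟ 0ℤ | d ℤ.≟ 0ℤ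
    ... | no c≢0   | _        = hc c≢0
    ... | yes _    | no d≢0   = hd d≢0
    ... | yes refl | yes refl = contradiction refl ≢0

    supported? : ∀ F → Decidable {A = Monomial} (All (_∈ F))
    supported? F = all? (_∈? F)

  symmetric-coeff : ∀ {F r} (x : Sym F r) (π : A ↔ A) → (∀ {a} → a ∉ F → Inverse.to π a ≡ a) →
                    ∀ w → coeff (poly x) (map (Inverse.from π) w) ≡ coeff (poly x) w
  symmetric-coeff x π fix w = trans (sym (coeff-rename π (poly x) w)) (coeff-≡ (symmetric x π fix) w)

  unsupported : ∀ {F r} (x : Sym F r) {w} → ¬ All (_∈ F) w → coeff (poly x) w ≡ 0ℤ
  unsupported x {w} ¬⊆ = decidable-stable (coeff (poly x) w ℤ.≟ 0ℤ) λ ≢0 → ¬⊆ (supported x w ≢0)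

  -- Elements of Sym F r may be compared on monomials in F only.
  ≈-on : ∀ {F r} (x y : Sym F r) → (∀ w → All (_∈ F) w → coeff (poly x) w ≡ coeff (poly y) w) → poly x ≈ₚ poly y
  ≈-on {F} x y h = mk≈ agree
    where
    agree : ∀ w → coeff (poly x) w ≡ coeff (poly y) w
    agree w with supported? F w
    ... | yes w⊆F = h w w⊆F
    ... | no  w⊈F = trans (unsupported x w⊈F) (sym (unsupported y w⊈F))

  addSym : ∀ {F r} → Sym F r → Sym F r → Sym F r
  addSym {F} {r} x y = record
    { poly        = poly x +ₚ poly y
    ; supported   = λ w → stable (coeff-+ (poly x) (poly y) w)
                      (+-support (supported? F w) _ _ (supported x w) (supported y w))
    ; homogeneous = λ w → stable (coeff-+ (poly x) (poly y) w)
                      (+-support (length w ℕ.≟ r) _ _ (homogeneous x w) (homogeneous y w))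
    ; symmetric   = λ π fix → ≈-trans (mk≈ λ w → cong (λ p → coeff p w) (List.map-++ _ (poly x) (poly y)))
                      (+ₚ-cong (symmetric x π fix) (symmetric y π fix))
    }

  zeroSym : ∀ {F r} → Sym F r
  zeroSym = record
    { poly        = 0ₚ
    ; supported   = λ w ≢0 → contradiction refl ≢0
    ; homogeneous = λ w ≢0 → contradiction refl ≢0
    ; symmetric   = λ _ _ → ≈-refl
    }

  negSym : ∀ {F r} → Sym F r → Sym F r
  negSym x = record
    { poly        = -ₚ poly x
    ; supported   = λ w ≢0 → supported x w (neg≢0 w ≢0)
    ; homogeneous = λ w ≢0 → homogeneous x w (neg≢0 w ≢0)
    ; symmetric   = λ π fix → mk≈ λ w → begin
        coeff (rename (Inverse.to π) (-ₚ poly x)) w   ≡⟨ coeff-rename π (-ₚ poly x) w ⟩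
        coeff (-ₚ poly x) (map (Inverse.from π) w)    ≡⟨ coeff-neg (poly x) _ ⟩
        - coeff (poly x) (map (Inverse.from π) w)     ≡⟨ cong -_ (symmetric-coeff x π fix w) ⟩
        - coeff (poly x) w                            ≡⟨ coeff-neg (poly x) w ⟨
        coeff (-ₚ poly x) w                           ∎
    }
    where
    open ≡-Reasoning
    neg≢0 : ∀ w → coeff (-ₚ poly x) w ≢ 0ℤ → coeff (poly x) w ≢ 0ℤ
    neg≢0 w ≢0 e = ≢0 (trans (coeff-neg (poly x) w) (cong -_ e))

  mulSym : ∀ {F r s} → Sym F r → Sym F s → Sym F (r ℕ.+ s)
  mulSym {F} {r} {s} x y = record
    { poly        = poly x *ₚ poly y
    ; supported   = *ₚ-support (supported? F) ↭.All-resp-↭ (poly x) (poly y)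
                      λ u v ≢0ᵤ ≢0ᵥ → All.++⁺ (supported x u ≢0ᵤ) (supported y v ≢0ᵥ)
    ; homogeneous = *ₚ-support (λ w → length w ℕ.≟ r ℕ.+ s) (λ u↭v e → trans (sym (↭.↭-length u↭v)) e) (poly x) (poly y)
                      λ u v ≢0ᵤ ≢0ᵥ → trans (List.length-++ u) (cong₂ ℕ._+_ (homogeneous x u ≢0ᵤ) (homogeneous y v ≢0ᵥ))
    ; symmetric   = λ π fix → ≈-trans (rename-* (Inverse.to π) (poly x) (poly y))
                      (*ₚ-cong (symmetric x π fix) (symmetric y π fix))
    }

  oneSym : ∀ {F} → Sym F 0
  oneSym {F} = record
    { poly        = 1ₚ
    ; supported   = supp
    ; homogeneous = λ { [] _ → refl ; (_ ∷ _) ≢0 → contradiction refl ≢0 }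
    ; symmetric   = λ _ _ → ≈-refl
    }
    where
    supp : ∀ w → coeff 1ₚ w ≢ 0ℤ → All (_∈ F) w
    supp []      _  = []
    supp (_ ∷ _) ≢0 = contradiction refl ≢0

  poly-subst : ∀ {F r s} (e : r ≡ s) (x : Sym F r) {p} → poly x ≈ₚ p → poly (subst (Sym F) e x) ≈ₚ p
  poly-subst refl x h = h

  SymRing : List A → GradedRing
  SymRing F = record
    { Carrier = Sym F
    ; _≈_ = λ x y → poly x ≈ₚ poly y
    ; _⊞_ = addSym
    ; 0# = zeroSym
    ; ⊟_ = negSym
    ; _⊠_ = mulSym
    ; 1# = oneSym
    ; ⊞-isAbelianGroup = λ r → record
        { isGroup = record
          { isMonoid = record
            { isSemigroup = record
              { isMagma = record
                { isEquivalence = record { refl = ≈-refl ; sym = ≈-sym ; trans = ≈-trans }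
                ; ∙-cong = +ₚ-cong }
              ; assoc = λ x y z → +ₚ-assoc (poly x) (poly y) (poly z) }
            ; identity = (λ x → ≈-refl) , (λ x → +ₚ-identityʳ (poly x)) }
          ; inverse = (λ x → ≈-trans (+ₚ-comm (-ₚ poly x) (poly x)) (+ₚ-inverseʳ (poly x)))
                    , (λ x → +ₚ-inverseʳ (poly x))
          ; ⁻¹-cong = -ₚ-cong }
        ; comm = λ x y → +ₚ-comm (poly x) (poly y) }
    ; ⊠-cong = *ₚ-cong
    ; ⊠-assoc = λ {r} {s} {t} x y z → poly-subst (ℕ.+-assoc r s t) (mulSym (mulSym x y) z) (*ₚ-assoc (poly x) (poly y) (poly z))
    ; ⊠-identityˡ = λ x → *ₚ-identityˡ (poly x)
    ; ⊠-identityʳ = λ {r} x → poly-subst (ℕ.+-identityʳ r) (mulSym x oneSym) (*ₚ-identityʳ (poly x))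
    ; ⊠-distribˡ = λ x y z → *ₚ-distribˡ (poly x) (poly y) (poly z)
    ; ⊠-distribʳ = λ x y z → *ₚ-distribʳ (poly x) (poly y) (poly z)
    }

  _≐_∖_ : List A → List A → Pred A 0ℓ → Set
  G ≐ F ∖ Z = ∀ {a} → a ∈ G ⇔ (a ∈ F × ¬ Z a)

  module _ {Z : Pred A 0ℓ} (Z? : Decidable Z) {F G : List A} (G≐F∖Z : G ≐ F ∖ Z) where

    private
      module E {a} = Equivalence (G≐F∖Z {a})

      setZero-support : ∀ {P : Set} p w → (coeff p w ≢ 0ℤ → P) → coeff (setZero Z? p) w ≢ 0ℤ → All (¬_ ∘ Z) w × P
      setZero-support p w h ≢0 with alive? Z? w
      ... | inj₁ alive = alive , h (λ e → ≢0 (trans (coeff-setZero-alive Z? p alive) e))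
      ... | inj₂ dead  = contradiction (coeff-setZero-dead Z? p dead) ≢0

    setZeroSym : ∀ {r} → Sym F r → Sym G r
    setZeroSym x = record
      { poly        = setZero Z? (poly x)
      ; supported   = λ w ≢0 → let (alive , w⊆F) = setZero-support (poly x) w (supported x w) ≢0 in
                        All.zipWith E.from (w⊆F , alive)
      ; homogeneous = λ w ≢0 → proj₂ (setZero-support (poly x) w (homogeneous x w) ≢0)
      ; symmetric   = λ π fix → mk≈ λ w → trans (coeff-rename π (setZero Z? (poly x)) w) (invariant π fix w)
      }
      where
      open ≡-Reasoning
      invariant : ∀ (π : A ↔ A) → (∀ {a} → a ∉ G → Inverse.to π a ≡ a) → ∀ w →
                  coeff (setZero Z? (poly x)) (map (Inverse.from π) w) ≡ coeff (setZero Z? (poly x)) w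
      invariant π fix w with alive? Z? w
      ... | inj₁ alive = begin
        coeff (setZero Z? (poly x)) (map from w)   ≡⟨ coeff-setZero-alive Z? (poly x) (All.map⁺ (All.map alive-from alive)) ⟩
        coeff (poly x) (map from w)                ≡⟨ symmetric-coeff x π (λ a∉F → fix (a∉F ∘ proj₁ ∘ E.to)) w ⟩
        coeff (poly x) w                           ≡⟨ coeff-setZero-alive Z? (poly x) alive ⟨
        coeff (setZero Z? (poly x)) w              ∎
        where
        open Inverse π
        alive-from : ∀ {a} → ¬ Z a → ¬ Z (from a)
        alive-from {a} ¬Za Zb = ¬Za (subst Z (trans (sym (fix λ b∈G → proj₂ (E.to b∈G) Zb)) (strictlyInverseˡ a)) Zb)
      ... | inj₂ dead  = trans (coeff-setZero-dead Z? (poly x) (Any.map⁺ (Any.map dead-from dead)))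
                               (sym (coeff-setZero-dead Z? (poly x) dead))
        where
        open Inverse π
        dead-from : ∀ {a} → Z a → Z (from a)
        dead-from {a} Za = subst Z (trans (sym (strictlyInverseʳ a)) (cong from (fix λ a∈G → proj₂ (E.to a∈G) Za))) Za

    coeff-setZeroSym : ∀ {r} (x : Sym F r) {w} → All (_∈ G) w → coeff (setZero Z? (poly x)) w ≡ coeff (poly x) w
    coeff-setZeroSym x w⊆G = coeff-setZero-alive Z? (poly x) (All.map (proj₂ ∘ E.to) w⊆G)

    setZeroHom : Hom (SymRing F) (SymRing G)
    setZeroHom = record
      { ⟦_⟧ = setZeroSym
      ; isHomomorphism = record
        { isGroupHomomorphism = λ r → record
          { isMonoidHomomorphism = record
            { isMagmaHomomorphism = record
              { isRelHomomorphism = record { cong = λ {x} {y} x≈y → ≈-on (setZeroSym x) (setZeroSym y) λ w w⊆G →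
                  trans (coeff-setZeroSym x w⊆G) (trans (coeff-≡ x≈y w) (sym (coeff-setZeroSym y w⊆G))) }
              ; homo = λ x y → ≈-on (setZeroSym (addSym x y)) (addSym (setZeroSym x) (setZeroSym y)) λ w w⊆G → begin
                  coeff (setZero Z? (poly x +ₚ poly y)) w
                    ≡⟨ coeff-setZeroSym (addSym x y) w⊆G ⟩
                  coeff (poly x +ₚ poly y) w
                    ≡⟨ coeff-+ (poly x) (poly y) w ⟩
                  coeff (poly x) w + coeff (poly y) w
                    ≡⟨ cong₂ _+_ (coeff-setZeroSym x w⊆G) (coeff-setZeroSym y w⊆G) ⟨
                  coeff (setZero Z? (poly x)) w + coeff (setZero Z? (poly y)) w
                    ≡⟨ coeff-+ (setZero Z? (poly x)) (setZero Z? (poly y)) w ⟨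
                  coeff (setZero Z? (poly x) +ₚ setZero Z? (poly y)) w
                    ∎ }
            ; ε-homo = ≈-refl }
          ; ⁻¹-homo = λ x → ≈-on (setZeroSym (negSym x)) (negSym (setZeroSym x)) λ w w⊆G → begin
              coeff (setZero Z? (-ₚ poly x)) w   ≡⟨ coeff-setZeroSym (negSym x) w⊆G ⟩
              coeff (-ₚ poly x) w                ≡⟨ coeff-neg (poly x) w ⟩
              - coeff (poly x) w                 ≡⟨ cong -_ (coeff-setZeroSym x w⊆G) ⟨
              - coeff (setZero Z? (poly x)) w    ≡⟨ coeff-neg (setZero Z? (poly x)) w ⟨
              coeff (-ₚ setZero Z? (poly x)) w   ∎ }
        ; ⊠-homo  = λ x y → setZero-* Z? (poly x) (poly y)
        ; 1#-homo = ≈-on (setZeroSym oneSym) oneSym λ w → coeff-setZeroSym oneSym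
        }
      }
      where open ≡-Reasoning

  restrict : ∀ {F G} → G ⊆ F → Hom (SymRing F) (SymRing G)
  restrict {F} {G} G⊆F = setZeroHom (λ a → ¬? (a ∈? G))
    (λ {a} → mk⇔ (λ a∈G → G⊆F a∈G , λ a∉G → a∉G a∈G) (λ (_ , ¬a∉G) → decidable-stable (a ∈? G) ¬a∉G))

  -- Symmetric functions: the variables are all of A, the limit is over the finite subsets of A.
  SymmetricFunctions : GradedRing
  SymmetricFunctions = Limit _⊆_ SymRing restrict

  at-coeff : ∀ {r} (x : GradedRing.Carrier SymmetricFunctions r) {F G} (F⊆G : F ⊆ G) {w} → All (_∈ F) w →
             coeff (poly (Limits.at x G)) w ≡ coeff (poly (Limits.at x F)) w
  at-coeff x {F} {G} F⊆G {w} w⊆F = trans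
    (sym (coeff-setZero-alive (λ a → ¬? (a ∈? F)) (poly (Limits.at x G)) (All.map (λ a∈F a∉F → a∉F a∈F) w⊆F)))
    (coeff-≡ (Limits.compatible x F⊆G) w)

  -- Truncating to F and then setting Z to zero is natural in F.
  setZero-cone : ∀ {Y Z : Pred A 0ℓ} (Y? : Decidable Y) (Z? : Decidable Z) {F G : List A}
                 (G≐F∖Y : G ≐ F ∖ Y) (F≐F∖Z : F ≐ F ∖ Z) (G≐G∖Z : G ≐ G ∖ Z) →
                 setZeroHom Y? G≐F∖Y ∘ₕ (setZeroHom Z? F≐F∖Z ∘ₕ proj _⊆_ SymRing restrict F)
                 ≈ₕ setZeroHom Z? G≐G∖Z ∘ₕ proj _⊆_ SymRing restrict G
  setZero-cone Y? Z? {F} {G} G≐F∖Y F≐F∖Z G≐G∖Z x =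
    ≈-on (setZeroSym Y? G≐F∖Y (setZeroSym Z? F≐F∖Z xF)) (setZeroSym Z? G≐G∖Z xG) λ w w⊆G → begin
      coeff (setZero Y? (setZero Z? (poly xF))) w  ≡⟨ coeff-setZeroSym Y? G≐F∖Y (setZeroSym Z? F≐F∖Z xF) w⊆G ⟩
      coeff (setZero Z? (poly xF)) w               ≡⟨ coeff-setZeroSym Z? F≐F∖Z xF (All.map G⊆F w⊆G) ⟩
      coeff (poly xF) w                            ≡⟨ at-coeff x G⊆F w⊆G ⟩
      coeff (poly xG) w                            ≡⟨ coeff-setZeroSym Z? G≐G∖Z xG w⊆G ⟨
      coeff (setZero Z? (poly xG)) w               ∎
    where
    open ≡-Reasoning
    xF = Limits.at x F
    xG = Limits.at x G
    G⊆F : G ⊆ F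
    G⊆F a∈G = proj₁ (Equivalence.to G≐F∖Y a∈G)

  setZero-square : ∀ {Y Z : Pred A 0ℓ} (Y? : Decidable Y) (Z? : Decidable Z) {F G H K : List A}
                   (G≐F∖Y : G ≐ F ∖ Y) (K≐G∖Z : K ≐ G ∖ Z) (H≐F∖Z : H ≐ F ∖ Z) (K≐H∖Y : K ≐ H ∖ Y) →
                   setZeroHom Z? K≐G∖Z ∘ₕ setZeroHom Y? G≐F∖Y ≈ₕ setZeroHom Y? K≐H∖Y ∘ₕ setZeroHom Z? H≐F∖Z
  setZero-square Y? Z? {F} {G} {H} {K} G≐F∖Y K≐G∖Z H≐F∖Z K≐H∖Y x =
    ≈-on (setZeroSym Z? K≐G∖Z (setZeroSym Y? G≐F∖Y x)) (setZeroSym Y? K≐H∖Y (setZeroSym Z? H≐F∖Z x)) λ w w⊆K → begin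
      coeff (setZero Z? (setZero Y? (poly x))) w
        ≡⟨ coeff-setZeroSym Z? K≐G∖Z (setZeroSym Y? G≐F∖Y x) w⊆K ⟩
      coeff (setZero Y? (poly x)) w
        ≡⟨ coeff-setZeroSym Y? G≐F∖Y x (All.map (proj₁ ∘ Equivalence.to K≐G∖Z) w⊆K) ⟩
      coeff (poly x) w
        ≡⟨ coeff-setZeroSym Z? H≐F∖Z x (All.map (proj₁ ∘ Equivalence.to K≐H∖Y) w⊆K) ⟨
      coeff (setZero Z? (poly x)) w
        ≡⟨ coeff-setZeroSym Y? K≐H∖Y (setZeroSym Z? H≐F∖Z x) w⊆K ⟨
      coeff (setZero Y? (setZero Z? (poly x))) w
        ∎
    where open ≡-Reasoning

-- (p , μ₁ ∷ ⋯ ∷ μ_d ∷ []) stands for the indeterminate 𝐚_{(p+1)μ₁…μ_d}: p is counted from 0.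
Indeterminate : ℕ → Set
Indeterminate n = ℕ × List (Fin n)

_≟ᵢ_ : ∀ {n} → DecidableEquality (Indeterminate n)
_≟ᵢ_ = ≡-dec ℕ._≟_ (List.≡-dec Fin._≟_)

words : (n d : ℕ) → List (List (Fin n))
words n zero    = [ [] ]
words n (suc d) = cartesianProductWith _∷_ (allFin n) (words n d)

-- The indeterminates 𝐚_{pμ₁…μ_d} with 1 ≤ p ≤ m and 0 ≤ d ≤ k.
box : (n m k : ℕ) → List (Indeterminate n)
box n m k = cartesianProduct (upTo m) (concatMap (words n) (upTo (suc k)))

∈-words⁺ : ∀ {n} (μ : List (Fin n)) → μ ∈ words n (length μ)
∈-words⁺ []      = here refl
∈-words⁺ (i ∷ μ) = ∈.∈-cartesianProductWith⁺ _∷_ (∈.∈-allFin i) (∈-words⁺ μ)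

∈-words⁻ : ∀ {n} d {μ : List (Fin n)} → μ ∈ words n d → length μ ≡ d
∈-words⁻ zero    (here refl) = refl
∈-words⁻ {n} (suc d) μ∈ with ∈.∈-cartesianProductWith⁻ _∷_ (allFin n) (words n d) μ∈
... | _ , _ , _ , ν∈ , refl = cong suc (∈-words⁻ d ν∈)

∈-box : ∀ {n} m k {p} {μ : List (Fin n)} → (p , μ) ∈ box n m k ⇔ (p < m × length μ ≤ k)
∈-box {n} m k {p} {μ} = mk⇔ forth back
  where
  forth : (p , μ) ∈ box n m k → p < m × length μ ≤ k
  forth a∈ with ∈.∈-cartesianProduct⁻ (upTo m) (concatMap (words n) (upTo (suc k))) a∈
  ... | p∈ , μ∈ with find (∈.∈-concatMap⁻ (words n) {upTo (suc k)} μ∈)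
  ...   | d , d∈ , μ∈d rewrite ∈-words⁻ d μ∈d = ∈.∈-upTo⁻ p∈ , ℕ.≤-pred (∈.∈-upTo⁻ d∈)
  back : p < m × length μ ≤ k → (p , μ) ∈ box n m k
  back (p<m , l≤k) = ∈.∈-cartesianProduct⁺ (∈.∈-upTo⁺ p<m)
    (∈.∈-concatMap⁺ (words n) (lose (∈.∈-upTo⁺ (s≤s l≤k)) (∈-words⁺ μ)))

module Rings (n : ℕ) where

  open Symmetric (_≟ᵢ_ {n}) public

  index degree : Indeterminate n → ℕ
  index  (p , μ) = p
  degree (p , μ) = length μ

  box-remove : ∀ m k m′ k′ {Z : Pred (Indeterminate n) 0ℓ} →
               (∀ {a} → index a < m → degree a ≤ k → index a < m′ × degree a ≤ k′ × ¬ Z a) →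
               (∀ {a} → index a < m′ → degree a ≤ k′ → ¬ Z a → index a < m × degree a ≤ k) →
               box n m k ≐ box n m′ k′ ∖ Z
  box-remove m k m′ k′ there-to back-to = mk⇔
    (λ a∈ → let (p< , d≤) = Equivalence.to (∈-box m k) a∈
                (p<′ , d≤′ , ¬Z) = there-to p< d≤
            in Equivalence.from (∈-box m′ k′) (p<′ , d≤′) , ¬Z)
    (λ (a∈ , ¬Z) → let (p< , d≤) = Equivalence.to (∈-box m′ k′) a∈
                   in Equivalence.from (∈-box m k) (back-to p< d≤ ¬Z))

  remove-index : ∀ m k → box n m k ≐ box n (suc m) k ∖ (λ a → index a ≡ m)
  remove-index m k = box-remove m k (suc m) k (λ p< d≤ → ℕ.m<n⇒m<1+n p< , d≤ , ℕ.<⇒≢ p<)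
                            (λ p< d≤ p≢ → ℕ.≤∧≢⇒< (ℕ.≤-pred p<) p≢ , d≤)

  remove-degree : ∀ m k → box n m k ≐ box n m (suc k) ∖ (λ a → degree a ≡ suc k)
  remove-degree m k = box-remove m k m (suc k) (λ p< d≤ → p< , ℕ.m≤n⇒m≤1+n d≤ , ℕ.<⇒≢ (s≤s d≤))
                             (λ p< d≤ d≢ → p< , ℕ.≤-pred (ℕ.≤∧≢⇒< d≤ d≢))

  remove-no-index : ∀ m k → box n m k ≐ box n m k ∖ (λ a → m ≤ index a)
  remove-no-index m k = box-remove m k m k (λ p< d≤ → p< , d≤ , ℕ.<⇒≱ p<) (λ p< d≤ _ → p< , d≤)

  remove-no-degree : ∀ m k → box n m k ≐ box n m k ∖ (λ a → k < degree a)
  remove-no-degree m k = box-remove m k m k (λ p< d≤ → p< , d≤ , ℕ.≤⇒≯ d≤) (λ p< d≤ _ → p< , d≤)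

  Λ[_,_] : ℕ → ℕ → GradedRing
  Λ[ m , k ] = SymRing (box n m k)

  h : ∀ m k → Hom Λ[ suc m , k ] Λ[ m , k ]
  h m k = setZeroHom (λ a → index a ℕ.≟ m) (remove-index m k)

  v : ∀ m k → Hom Λ[ m , suc k ] Λ[ m , k ]
  v m k = setZeroHom (λ a → degree a ℕ.≟ suc k) (remove-degree m k)

  -- Λ[∙, k ] is a limit over m ≥ 1: position i of a sequence carries m = suc i.
  Λ[∙,_] Λ[_,∙] : ℕ → GradedRing
  Λ[∙, k ] = SequentialLimit (λ i → Λ[ suc i , k ]) (λ i → h (suc i) k)
  Λ[ m ,∙] = SequentialLimit (λ k → Λ[ m , k ]) (v m)

  hLim : ∀ m → Hom Λ[ suc m ,∙] Λ[ m ,∙]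
  hLim m = seqMap (h m) λ k → setZero-square (λ a → index a ℕ.≟ m) (λ a → degree a ℕ.≟ suc k)
             (remove-index m (suc k)) (remove-degree m k) (remove-degree (suc m) k) (remove-index m k)

  vLim : ∀ k → Hom Λ[∙, suc k ] Λ[∙, k ]
  vLim k = seqMap (λ i → v (suc i) k) λ i → setZero-square (λ a → degree a ℕ.≟ suc k) (λ a → index a ℕ.≟ suc i)
             (remove-degree (suc (suc i)) k) (remove-index (suc i) k) (remove-index (suc i) (suc k)) (remove-degree (suc i) k)

  φ : ∀ {m₁ m₂} → m₁ ≤ m₂ → Hom Λ[ m₂ ,∙] Λ[ m₁ ,∙]
  φ = composite Λ[_,∙] hLim

  ψ : ∀ {k₁ k₂} → k₁ ≤ k₂ → Hom Λ[∙, k₂ ] Λ[∙, k₁ ]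
  ψ = composite Λ[∙,_] vLim

  limφ limψ : GradedRing
  limφ = InverseLimit ℕ⁺-directed (λ (m , _) → Λ[ m ,∙]) φ
  limψ = InverseLimit ℕ-directed Λ[∙,_] ψ

  Λ : GradedRing
  Λ = SymmetricFunctions

  truncate : ∀ m k → Hom Λ Λ[ m , k ]
  truncate m k = proj _⊆_ SymRing restrict (box n m k)

  projφ : ∀ m (1≤m : 1 ≤ m) k → Hom limφ Λ[ m , k ]
  projφ m 1≤m k = seqProj (λ k → Λ[ m , k ]) (v m) k ∘ₕ proj _ _ φ (m , 1≤m)

  projψ : ∀ m (1≤m : 1 ≤ m) k → Hom limψ Λ[ m , k ]
  projψ (suc i) _ k = seqProj (λ i → Λ[ suc i , k ]) (λ i → h (suc i) k) i ∘ₕ proj _ _ ψ k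

  -- H m and V k set indeterminates to zero in every truncation of a symmetric function;
  -- since p is counted from 0, "p > m" reads m ≤ index.
  H : ∀ m → Hom Λ Λ[ m ,∙]
  H m = seqLift (λ k → Λ[ m , k ]) (v m)
    (λ k → setZeroHom (λ a → m ℕ.≤? index a) (remove-no-index m k) ∘ₕ truncate m k)
    λ k → setZero-cone (λ a → degree a ℕ.≟ suc k) (λ a → m ℕ.≤? index a)
            (remove-degree m k) (remove-no-index m (suc k)) (remove-no-index m k)

  V : ∀ k → Hom Λ Λ[∙, k ]
  V k = seqLift (λ i → Λ[ suc i , k ]) (λ i → h (suc i) k)
    (λ i → setZeroHom (λ a → k ℕ.<? degree a) (remove-no-degree (suc i) k) ∘ₕ truncate (suc i) k)
    λ i → setZero-cone (λ a → index a ℕ.≟ suc i) (λ a → k ℕ.<? degree a)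
            (remove-index (suc i) k) (remove-no-degree (suc (suc i)) k) (remove-no-degree (suc i) k)

{-# OPTIONS --safe #-}

-- A monomial of degree r involves at most r indeterminates. Hence a symmetric polynomial of degree r
-- in a finite set F of at least r indeterminates has a unique extension to a symmetric function: to
-- read off its coefficient at a monomial w, move w into F by a permutation of the indeterminates.
-- An element of degree r of Λ[ m ,∙] or Λ[∙, k ] contains such a polynomial at a sufficiently late
-- position, and its extension is a preimage under H m or V k; since φ ∘ H = H and ψ ∘ V = V, the
-- maps φ and ψ are surjective as well. A symmetric function is recovered from its truncations to the
-- boxes, because every finite set of indeterminates lies in a box; this inverts Λ → limφ and Λ → limψ.
module Submission where

open import Defs
open import Level using (0ℓ)
open import Function using (_∘_; case_of_)
open import Function.Bundles using (_↔_; mk↔ₛ′; Inverse; Equivalence)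
open import Function.Consequences.Propositional using (inverseʳ⇒injective)
open import Function.Construct.Composition using (_↔-∘_)
open import Function.Construct.Identity using (↔-id)
open import Function.Construct.Symmetry using (↔-sym)
open import Function.Definitions using (Injective)
open import Data.Bool.Base using (if_then_else_)
open import Data.Fin.Base using (Fin)
import Data.Fin.Base as Fin
import Data.Fin.Properties as Fin
open import Data.Integer.Base using (ℤ; 0ℤ; _+_)
import Data.Integer.Properties as ℤ
open import Data.List.Base using (List; []; _∷_; map; length; cartesianProductWith; lookup; replicate)
open import Data.List.Extrema.Nat using (max; xs≤max)
import Data.List.Properties as List
open import Data.List.Membership.Propositional using (_∈_; _∉_; find; lose)
import Data.List.Membership.Propositional.Properties as ∈
open import Data.List.Relation.Binary.Permutation.Propositional using (_↭_; ↭-refl; ↭-sym; ↭-trans)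
import Data.List.Relation.Binary.Permutation.Propositional.Properties as ↭
open import Data.List.Relation.Binary.Subset.Propositional using (_⊆_)
open import Data.List.Relation.Unary.All using (All; []; _∷_; all?)
import Data.List.Relation.Unary.All as All
import Data.List.Relation.Unary.All.Properties as All
open import Data.List.Relation.Unary.Any using (Any; here; there; any?)
import Data.List.Relation.Unary.Any as Any
import Data.List.Relation.Unary.Any.Properties as Any
open import Data.Nat.Base as ℕ using (ℕ; zero; suc; _≤_; _<_; z≤n; s≤s; _≤′_; ≤′-reflexive; ≤′-step)
import Data.Nat.Properties as ℕ
open import Data.Product.Base using (Σ; ∃; _×_; _,_; proj₁; proj₂)
open import Relation.Binary.Definitions using (DecidableEquality)
open import Relation.Binary.PropositionalEquality using (_≡_; _≢_; refl; sym; trans; cong; cong₂; subst; module ≡-Reasoning)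
open import Relation.Nullary using (¬_; Dec; yes; no; does; contradiction; ¬?)
open import Relation.Nullary.Decidable using (dec-true; dec-false; decidable-stable)
open import Relation.Unary using (Pred; Decidable)

open Limits using (at; compatible)

-- Surjectivity on direct sums, and invariants of composites.

-- A chosen preimage of zero need not be zero, so from the finiteness bound `N` on it is replaced by
-- `A.0#` to stay in the direct sum.
componentwise-surjective : ∀ {A B} (f : Hom A B) →
  (∀ {r} (y : GradedRing.Carrier B r) → ∃ λ x → GradedRing._≈_ B (⟦ f ⟧ x) y) →
  IsSurjectiveHomomorphism A B ⟦ f ⟧
componentwise-surjective {A} {B} f preimage = Hom.isHomomorphism f , λ y →
  let open B.⨁ y
      N , zero-from = finite
  in record { component = λ r → truncated (component r) (r ℕ.<? N)
            ; finite = N , λ r N≤r → truncated-zero (component r) (r ℕ.<? N) N≤r }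
   , λ z≈ r → B.≈-trans (Hom.f-cong f (z≈ r)) (image-truncated (component r) (r ℕ.<? N) (zero-from r))
  where
  module A = GradedRing A
  module B = GradedRing B
  truncated : ∀ {r N} → B.Carrier r → Dec (r < N) → A.Carrier r
  truncated y (yes _) = proj₁ (preimage y)
  truncated y (no _)  = A.0#
  truncated-zero : ∀ {r N} (y : B.Carrier r) (d : Dec (r < N)) → N ≤ r → truncated y d A.≈ A.0#
  truncated-zero y (yes r<N) N≤r = contradiction N≤r (ℕ.<⇒≱ r<N)
  truncated-zero y (no _)    _   = A.≈-refl
  image-truncated : ∀ {r N} (y : B.Carrier r) (d : Dec (r < N)) → (N ≤ r → y B.≈ B.0#) → ⟦ f ⟧ (truncated y d) B.≈ y
  image-truncated y (yes _)  _      = proj₂ (preimage y)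
  image-truncated y (no r≮N) y-zero = B.≈-trans (Hom.0#-homo f) (B.≈-sym (y-zero (ℕ.≮⇒≥ r≮N)))

surjective-cancel : ∀ {A B C} (g : Hom B C) (f : Hom A B) (h : Hom A C) → g ∘ₕ f ≈ₕ h →
  (∀ {r} (y : GradedRing.Carrier C r) → ∃ λ x → GradedRing._≈_ C (⟦ h ⟧ x) y) →
  ∀ {r} (y : GradedRing.Carrier C r) → ∃ λ x → GradedRing._≈_ C (⟦ g ⟧ x) y
surjective-cancel {C = C} g f h g∘f≈h preimage y with preimage y
... | x , hx≈y = ⟦ f ⟧ x , GradedRing.≈-trans C (g∘f≈h x) hx≈y

-- Used with `c` reading off the coefficient of a fixed monomial. `step` is demanded only from `i`
-- upwards, where all indeterminates of that monomial are present.
composite-invariant : ∀ (A : ℕ → GradedRing) (f : ∀ i → Hom (A (suc i)) (A i)) {X : Set} {r}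
  (c : ∀ i → GradedRing.Carrier (A i) r → X) {i} →
  (∀ {l} → i ≤ l → ∀ y → c l (⟦ f l ⟧ y) ≡ c (suc l) y) →
  ∀ {j} (i≤j : i ≤ j) (y : GradedRing.Carrier (A j) r) → c i (⟦ Sequence.composite A f i≤j ⟧ y) ≡ c j y
composite-invariant A f {r = r} c {i} step i≤j = go (ℕ.≤⇒≤′ i≤j)
  where
  go : ∀ {j} (i≤j : i ≤′ j) (y : GradedRing.Carrier (A j) r) → c i (⟦ Sequence.composite′ A f i≤j ⟧ y) ≡ c j y
  go (≤′-reflexive refl)  y = refl
  go (≤′-step {n = l} i≤l) y = trans (go i≤l (⟦ f l ⟧ y)) (step (ℕ.≤′⇒≤ i≤l) y)

module Extension {A : Set} (_≟_ : DecidableEquality A) where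

  open Symmetric _≟_
  open import Data.List.Membership.DecPropositional _≟_ using (_∈?_)

  -- Permutations of the indeterminates.

  transpose : A → A → A → A
  transpose x y z with z ≟ x | z ≟ y
  ... | yes _ | _     = y
  ... | no _  | yes _ = x
  ... | no _  | no _  = z

  transposeˡ : ∀ x y → transpose x y x ≡ y
  transposeˡ x y with x ≟ x | x ≟ y
  ... | yes _ | _ = refl
  ... | no x≢ | _ = contradiction refl x≢

  transposeʳ : ∀ x y → transpose x y y ≡ x
  transposeʳ x y with y ≟ x | y ≟ y
  ... | yes e | _     = e
  ... | no _  | yes _ = refl
  ... | no _  | no y≢ = contradiction refl y≢

  transpose-≢ : ∀ {x y z} → z ≢ x → z ≢ y → transpose x y z ≡ z
  transpose-≢ {x} {y} {z} z≢x z≢y with z ≟ x | z ≟ y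
  ... | yes e | _     = contradiction e z≢x
  ... | no _  | yes e = contradiction e z≢y
  ... | no _  | no _  = refl

  transpose-involutive : ∀ x y z → transpose x y (transpose x y z) ≡ z
  transpose-involutive x y z with z ≟ x | z ≟ y
  ... | yes refl | _        = transposeʳ x y
  ... | no _     | yes refl = transposeˡ x y
  ... | no z≢x   | no z≢y   = transpose-≢ z≢x z≢y

  transposition : A → A → A ↔ A
  transposition x y = mk↔ₛ′ (transpose x y) (transpose x y) (transpose-involutive x y) (transpose-involutive x y)

  to-injective : (π : A ↔ A) → Injective _≡_ _≡_ (Inverse.to π)
  to-injective π = inverseʳ⇒injective (Inverse.to π) (Inverse.inverseʳ π)

  FixesOutside : List A → A ↔ A → Set
  FixesOutside F π = ∀ {a} → a ∉ F → Inverse.to π a ≡ a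

  -- An image outside `F` would be fixed by `π`, hence equal to `a` by injectivity.
  to-∈ : ∀ {F} (π : A ↔ A) → FixesOutside F π → ∀ {a} → a ∈ F → Inverse.to π a ∈ F
  to-∈ {F} π fix {a} a∈F = decidable-stable (Inverse.to π a ∈? F) λ πa∉F →
    πa∉F (subst (_∈ F) (sym (to-injective π (fix πa∉F))) a∈F)

  -- Induction on `u`: a permutation correct on the tail is followed by the transposition of its
  -- value at `a` with `f a`. Both swapped points lie in `F`, so nothing outside `F` moves.
  injection-extends : ∀ {F} {f : A → A} → Injective _≡_ _≡_ f → ∀ {u} → All (_∈ F) u → All (_∈ F) (map f u) →
                      ∃ λ π → FixesOutside F π × All (λ a → Inverse.to π a ≡ f a) u
  injection-extends f-inj [] [] = ↔-id A , (λ _ → refl) , []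
  injection-extends {F} {f} f-inj {a ∷ u} (a∈F ∷ u⊆F) (fa∈F ∷ fu⊆F) with injection-extends f-inj u⊆F fu⊆F
  ... | π , fix , agree = transposition (to a) (f a) ↔-∘ π , fix′ , transposeˡ (to a) (f a) ∷ All.map agree′ agree
    where
    open Inverse π
    fix′ : ∀ {b} → b ∉ F → transpose (to a) (f a) (to b) ≡ b
    fix′ {b} b∉F rewrite fix b∉F =
      transpose-≢ (λ b≡ → b∉F (subst (_∈ F) (sym b≡) (to-∈ π fix a∈F))) (λ b≡ → b∉F (subst (_∈ F) (sym b≡) fa∈F))
    agree′ : ∀ {b} → to b ≡ f b → transpose (to a) (f a) (to b) ≡ f b
    agree′ {b} e with b ≟ a
    -- The tail may contain `a` again; any other `b` has `f b` distinct from both swapped points.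
    ... | yes refl = transposeˡ (to a) (f a)
    ... | no b≢a   = trans (transpose-≢ (b≢a ∘ to-injective π) λ e′ → b≢a (f-inj (trans (sym e) e′))) e

  -- Symmetry speaks only of permutations fixing the complement of `F`. One of these has the same
  -- values as `f` on `u`, even if `f` does not preserve `F`.
  coeff-map : ∀ {F r} (x : Sym F r) {f : A → A} → Injective _≡_ _≡_ f → ∀ {u} →
              All (_∈ F) u → All (_∈ F) (map f u) → coeff (poly x) (map f u) ≡ coeff (poly x) u
  coeff-map x {f} f-inj {u} u⊆F fu⊆F with injection-extends f-inj u⊆F fu⊆F
  ... | π , fix , agree = begin
    coeff (poly x) (map f u)              ≡⟨ symmetric-coeff x π fix (map f u) ⟨
    coeff (poly x) (map from (map f u))   ≡⟨ cong (coeff (poly x) ∘ map from) (List.map-cong-local agree) ⟨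
    coeff (poly x) (map from (map to u))  ≡⟨ cong (coeff (poly x)) (List.map-∘ u) ⟨
    coeff (poly x) (map (from ∘ to) u)    ≡⟨ cong (coeff (poly x)) (trans (List.map-cong strictlyInverseʳ u) (List.map-id u)) ⟩
    coeff (poly x) u                      ∎
    where
    open Inverse π
    open ≡-Reasoning

  -- Moving monomials into a large finite set.

  -- Equivalently, F has at least r distinct elements.
  Large : List A → ℕ → Set
  Large F r = ∀ u → length u < r → ∃ λ y → y ∈ F × y ∉ u

  -- Pigeonhole: if `u` contained all of the `r` points, their positions would inject `Fin r` into a
  -- smaller `Fin`.
  injection⇒Large : ∀ {F r} (e : ℕ → A) → Injective _≡_ _≡_ e → (∀ {i} → i < r → e i ∈ F) → Large F r
  injection⇒Large {F} {r} e e-inj e∈F u l<r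
    with Fin.any? {n = r} (λ i → ¬? (e (Fin.toℕ i) ∈? u))
  ... | yes (i , ∉u) = e (Fin.toℕ i) , e∈F (Fin.toℕ<n i) , ∉u
  ... | no ¬∃ = contradiction (Fin.injective⇒≤ {f = Any.index ∘ e∈u} index-injective) (ℕ.<⇒≱ l<r)
    where
    e∈u : ∀ (i : Fin r) → e (Fin.toℕ i) ∈ u
    e∈u i = decidable-stable (e (Fin.toℕ i) ∈? u) λ ∉u → ¬∃ (i , ∉u)
    index-injective : Injective _≡_ _≡_ (Any.index ∘ e∈u)
    index-injective {i} {j} eq = Fin.toℕ-injective (e-inj
      (trans (Any.lookup-index (e∈u i)) (trans (cong (lookup u) eq) (sym (Any.lookup-index (e∈u j))))))

  -- Induction on `u`: if the image of `a` misses `F`, it is swapped with some `y` in `F` not yet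
  -- used by the tail; such a `y` exists because the tail has fewer than `r` entries.
  embed : ∀ {F r} → Large F r → ∀ u → length u ≤ r → ∃ λ π → All (_∈ F) (map (Inverse.to π) u)
  embed large [] _ = ↔-id A , []
  embed {F} large (a ∷ u) l with embed large u (ℕ.≤-trans (ℕ.n≤1+n _) l)
  ... | π , πu⊆F with Inverse.to π a ∈? F
  ...   | yes πa∈F = π , πa∈F ∷ πu⊆F
  ...   | no πa∉F with large (map (Inverse.to π) u) (subst (_< _) (sym (List.length-map _ u)) l)
  ...     | y , y∈F , y∉πu = transposition (to a) y ↔-∘ π ,
              subst (_∈ F) (sym (transposeˡ (to a) y)) y∈F ∷ subst (All (_∈ F)) (sym unmoved) πu⊆F
    where
    open Inverse π
    -- The swap leaves the tail alone: its image lies in `F`, unlike `to a`, and avoids `y`.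
    fixed : ∀ {b} → b ∈ map to u → transpose (to a) y b ≡ b
    fixed b∈ = transpose-≢ (λ { refl → πa∉F (All.lookup πu⊆F b∈) }) (λ { refl → y∉πu b∈ })
    unmoved : map (transpose (to a) y ∘ to) u ≡ map to u
    unmoved = trans (List.map-∘ u) (trans (List.map-cong-local (All.tabulate fixed)) (List.map-id _))

  -- Polynomials with prescribed coefficients.

  -- Monomials are taken up to _↭_, so of those listed in ws only one from each class may contribute.
  fromCoefficients : (Monomial → ℤ) → List Monomial → Poly
  fromCoefficients c []       = 0ₚ
  fromCoefficients c (u ∷ ws) = if does (any? (_↭? u) ws) then fromCoefficients c ws else (c u , u) ∷ fromCoefficients c ws

  coeff-fromCoefficients-∉ : ∀ c ws {w} → ¬ Any (_↭ w) ws → coeff (fromCoefficients c ws) w ≡ 0ℤ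
  coeff-fromCoefficients-∉ c []       {w} ∉ws = refl
  coeff-fromCoefficients-∉ c (u ∷ ws) {w} ∉ws with any? (_↭? u) ws
  ... | yes _ = coeff-fromCoefficients-∉ c ws (∉ws ∘ there)
  ... | no _ rewrite dec-false (u ↭? w) (∉ws ∘ here) =
    trans (ℤ.+-identityˡ _) (coeff-fromCoefficients-∉ c ws (∉ws ∘ there))

  coeff-fromCoefficients-∈ : ∀ {c} → Invariant c → ∀ ws {w} → Any (_↭ w) ws → coeff (fromCoefficients c ws) w ≡ c w
  coeff-fromCoefficients-∈ {c} inv (u ∷ ws) {w} w∈ with any? (_↭? u) ws | u ↭? w
  -- Here `u` is dropped, but a later member of its class is still in `ws`.
  ... | yes u∈ | yes u↭w = coeff-fromCoefficients-∈ inv ws (Any.map (λ v↭u → ↭-trans v↭u u↭w) u∈)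
  ... | yes u∈ | no ¬u↭w = coeff-fromCoefficients-∈ inv ws (Any.tail ¬u↭w w∈)
  -- Here `u` is the last member of its class, so the remaining terms contribute zero at `w`.
  ... | no u∉  | yes u↭w rewrite dec-true (u ↭? w) u↭w = trans
    (cong₂ _+_ (inv u↭w) (coeff-fromCoefficients-∉ c ws (u∉ ∘ Any.map (λ v↭w → ↭-trans v↭w (↭-sym u↭w)))))
    (ℤ.+-identityʳ _)
  ... | no _   | no ¬u↭w rewrite dec-false (u ↭? w) ¬u↭w =
    trans (ℤ.+-identityˡ _) (coeff-fromCoefficients-∈ inv ws (Any.tail ¬u↭w w∈))

  -- These are ordered words, so one monomial is usually listed several times; `fromCoefficients`
  -- allows for this.
  monomials : List A → ℕ → List Monomial
  monomials F zero    = [] ∷ []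
  monomials F (suc r) = cartesianProductWith _∷_ F (monomials F r)

  ∈-monomials⁺ : ∀ {F w} → All (_∈ F) w → w ∈ monomials F (length w)
  ∈-monomials⁺ []          = here refl
  ∈-monomials⁺ (a∈F ∷ w⊆F) = ∈.∈-cartesianProductWith⁺ _∷_ a∈F (∈-monomials⁺ w⊆F)

  ∈-monomials⁻ : ∀ F r {w} → w ∈ monomials F r → All (_∈ F) w × length w ≡ r
  ∈-monomials⁻ F zero    (here refl) = [] , refl
  ∈-monomials⁻ F (suc r) w∈ with ∈.∈-cartesianProductWith⁻ _∷_ F (monomials F r) w∈
  ... | _ , _ , a∈F , v∈ , refl with ∈-monomials⁻ F r v∈
  ...   | v⊆F , e = a∈F ∷ v⊆F , cong suc e

  inhomogeneous : ∀ {F r} (x : Sym F r) {w} → length w ≢ r → coeff (poly x) w ≡ 0ℤ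
  inhomogeneous x {w} ≢r = decidable-stable (coeff (poly x) w ℤ.≟ 0ℤ) λ ≢0 → ≢r (homogeneous x w ≢0)

  coeff-restrict : ∀ {F G r} (G⊆F : G ⊆ F) (x : Sym F r) {w} → All (_∈ G) w →
                   coeff (poly (⟦ restrict G⊆F ⟧ x)) w ≡ coeff (poly x) w
  coeff-restrict {G = G} G⊆F x w⊆G =
    coeff-setZero-alive (λ a → ¬? (a ∈? G)) (poly x) (All.map (λ a∈G a∉G → a∉G a∈G) w⊆G)

  -- Extension of a symmetric polynomial to a symmetric function.

  module _ {F r} (large : Large F r) (x : Sym F r) where

    -- The only value symmetry allows in degree `r`, computed through the permutation that `embed`
    -- happens to choose; homogeneity forces zero in other degrees.
    extendedCoeff : Monomial → ℤ
    extendedCoeff w with length w ℕ.≟ r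
    ... | yes e = coeff (poly x) (map (Inverse.to (proj₁ (embed large w (ℕ.≤-reflexive e)))) w)
    ... | no _  = 0ℤ

    -- Independence of the chosen permutation: if `ρ` and `π` both move `w` into `F`, then `π` after
    -- the inverse of `ρ` carries one image to the other, and `coeff-map` applies.
    extendedCoeff-spec : ∀ (π : A ↔ A) {w} → All (_∈ F) (map (Inverse.to π) w) →
                         extendedCoeff w ≡ coeff (poly x) (map (Inverse.to π) w)
    extendedCoeff-spec π {w} πw⊆F with length w ℕ.≟ r
    ... | no ≢r = sym (inhomogeneous x (≢r ∘ trans (sym (List.length-map _ w))))
    ... | yes e with embed large w (ℕ.≤-reflexive e)
    ...   | ρ , ρw⊆F = begin
      coeff (poly x) (map ρ.to w)                         ≡⟨ coeff-map x τ-injective ρw⊆F (subst (All (_∈ F)) (sym τρw≡πw) πw⊆F) ⟨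
      coeff (poly x) (map (π.to ∘ ρ.from) (map ρ.to w))   ≡⟨ cong (coeff (poly x)) τρw≡πw ⟩
      coeff (poly x) (map π.to w)                         ∎
      where
      open ≡-Reasoning
      module π = Inverse π
      module ρ = Inverse ρ
      τ-injective : Injective _≡_ _≡_ (π.to ∘ ρ.from)
      τ-injective = to-injective (π ↔-∘ ↔-sym ρ)
      τρw≡πw : map (π.to ∘ ρ.from) (map ρ.to w) ≡ map π.to w
      τρw≡πw = trans (sym (List.map-∘ w)) (List.map-cong (λ a → cong π.to (ρ.strictlyInverseʳ a)) w)

    extendedCoeff-≢ : ∀ w → length w ≢ r → extendedCoeff w ≡ 0ℤ
    extendedCoeff-≢ w ≢r with length w ℕ.≟ r
    ... | yes e = contradiction e ≢r
    ... | no _  = refl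

    -- If `ρ` moves the image of `w` into `F`, then `ρ` after `π` moves `w` to the same monomial.
    extendedCoeff-map : ∀ (π : A ↔ A) w → extendedCoeff (map (Inverse.to π) w) ≡ extendedCoeff w
    extendedCoeff-map π w = case length w ℕ.≟ r of λ where
        (no ≢r) → trans (extendedCoeff-≢ (map to w) (≢r ∘ trans (sym (List.length-map _ w)))) (sym (extendedCoeff-≢ w ≢r))
        (yes e) → homogeneous-case (embed large (map to w) (ℕ.≤-reflexive (trans (List.length-map _ w) e)))
      where
      open Inverse π
      homogeneous-case : (∃ λ ρ → All (_∈ F) (map (Inverse.to ρ) (map to w))) →
                         extendedCoeff (map to w) ≡ extendedCoeff w
      homogeneous-case (ρ , ρπw⊆F) = begin
        extendedCoeff (map to w)                          ≡⟨ extendedCoeff-spec ρ ρπw⊆F ⟩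
        coeff (poly x) (map (Inverse.to ρ) (map to w))    ≡⟨ cong (coeff (poly x)) (List.map-∘ w) ⟨
        coeff (poly x) (map (Inverse.to (ρ ↔-∘ π)) w)     ≡⟨ extendedCoeff-spec (ρ ↔-∘ π) (subst (All (_∈ F)) (sym (List.map-∘ w)) ρπw⊆F) ⟨
        extendedCoeff w                                   ∎
        where open ≡-Reasoning

    extendedCoeff-invariant : Invariant extendedCoeff
    extendedCoeff-invariant {u} {v} u↭v = case length u ℕ.≟ r of λ where
        (no ≢r) → trans (extendedCoeff-≢ u ≢r) (sym (extendedCoeff-≢ v (≢r ∘ trans (↭.↭-length u↭v))))
        (yes e) → homogeneous-case (embed large u (ℕ.≤-reflexive e))
      where
      homogeneous-case : (∃ λ ρ → All (_∈ F) (map (Inverse.to ρ) u)) → extendedCoeff u ≡ extendedCoeff v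
      homogeneous-case (ρ , ρu⊆F) = begin
        extendedCoeff u       ≡⟨ extendedCoeff-spec ρ ρu⊆F ⟩
        coeff (poly x) (map (Inverse.to ρ) u) ≡⟨ coeff-resp-↭ (poly x) (↭.map⁺ (Inverse.to ρ) u↭v) ⟩
        coeff (poly x) (map (Inverse.to ρ) v) ≡⟨ extendedCoeff-spec ρ (↭.All-resp-↭ (↭.map⁺ (Inverse.to ρ) u↭v) ρu⊆F) ⟨
        extendedCoeff v       ∎
        where open ≡-Reasoning

    module _ (G : List A) where

      extendedPoly : Poly
      extendedPoly = fromCoefficients extendedCoeff (monomials G r)

      coeff-extendedPoly : ∀ {w} → All (_∈ G) w → coeff extendedPoly w ≡ extendedCoeff w
      coeff-extendedPoly {w} w⊆G = case length w ℕ.≟ r of λ where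
        (yes refl) → coeff-fromCoefficients-∈ extendedCoeff-invariant (monomials G r)
                       (lose (∈-monomials⁺ w⊆G) ↭-refl)
        (no ≢r) → trans (coeff-fromCoefficients-∉ extendedCoeff (monomials G r) λ w∈ →
                          let (_ , v∈ , v↭w) = find w∈ in
                          ≢r (trans (sym (↭.↭-length v↭w)) (proj₂ (∈-monomials⁻ G r v∈))))
                        (sym (extendedCoeff-≢ w ≢r))

      extendedPoly-support : ∀ w → coeff extendedPoly w ≢ 0ℤ → All (_∈ G) w × length w ≡ r
      extendedPoly-support w ≢0 with any? (_↭? w) (monomials G r)
      ... | no w∉  = contradiction (coeff-fromCoefficients-∉ extendedCoeff (monomials G r) w∉) ≢0
      ... | yes w∈ with find w∈
      ...   | v , v∈ , v↭w with ∈-monomials⁻ G r v∈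
      ...     | v⊆G , e = ↭.All-resp-↭ v↭w v⊆G , trans (sym (↭.↭-length v↭w)) e

      extendSym : Sym G r
      extendSym = record
        { poly        = extendedPoly
        ; supported   = λ w ≢0 → proj₁ (extendedPoly-support w ≢0)
        ; homogeneous = λ w ≢0 → proj₂ (extendedPoly-support w ≢0)
        ; symmetric   = λ π fix → mk≈ λ w → trans (coeff-rename π extendedPoly w)
                          -- Renaming by `π` reads coefficients through its inverse, which also
                          -- fixes everything outside `G`.
                          (invariant (↔-sym π) (λ {a} a∉G → to-injective π (trans (Inverse.strictlyInverseˡ π a) (sym (fix a∉G)))) w)
        }
        where
        open ≡-Reasoning
        invariant : ∀ π → FixesOutside G π → ∀ w →
                    coeff extendedPoly (map (Inverse.to π) w) ≡ coeff extendedPoly w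
        invariant π fix w with all? (_∈? G) w
        ... | yes w⊆G = begin
          coeff extendedPoly (map to w)   ≡⟨ coeff-extendedPoly (All.map⁺ (All.map (to-∈ π fix) w⊆G)) ⟩
          extendedCoeff (map to w)        ≡⟨ extendedCoeff-map π w ⟩
          extendedCoeff w                 ≡⟨ coeff-extendedPoly w⊆G ⟨
          coeff extendedPoly w            ∎
          where open Inverse π
        -- `π` maps the complement of `G` to itself, so both coefficients vanish.
        ... | no w⊈G = trans (vanish (w⊈G ∘ All.map to-∈⁻ ∘ All.map⁻)) (sym (vanish w⊈G))
          where
          open Inverse π
          vanish : ∀ {v} → ¬ All (_∈ G) v → coeff extendedPoly v ≡ 0ℤ
          vanish {v} v⊈G = decidable-stable (coeff extendedPoly v ℤ.≟ 0ℤ) (v⊈G ∘ proj₁ ∘ extendedPoly-support v)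
          to-∈⁻ : ∀ {a} → to a ∈ G → a ∈ G
          to-∈⁻ {a} πa∈G = decidable-stable (a ∈? G) λ a∉G → a∉G (subst (_∈ G) (fix a∉G) πa∈G)

    extend : GradedRing.Carrier SymmetricFunctions r
    extend = record
      { at         = extendSym
      ; compatible = λ {G} {H} G⊆H → ≈-on (⟦ restrict G⊆H ⟧ (extendSym H)) (extendSym G) λ w w⊆G →
          trans (coeff-restrict G⊆H (extendSym H) w⊆G)
            (trans (coeff-extendedPoly H (All.map G⊆H w⊆G)) (sym (coeff-extendedPoly G w⊆G)))
      }

    -- `F` and `G` need not be nested, so `x` and `y` are compared through a common extension `z`
    -- over `H`: its symmetry relates `w` in `G` to a permuted copy in `F`.
    extend-unique : ∀ {G H} (y : Sym G r) (z : Sym H r) → F ⊆ H → G ⊆ H →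
                    (∀ {w} → All (_∈ F) w → coeff (poly z) w ≡ coeff (poly x) w) →
                    (∀ {w} → All (_∈ G) w → coeff (poly z) w ≡ coeff (poly y) w) →
                    ∀ {w} → All (_∈ G) w → coeff (poly (extendSym G)) w ≡ coeff (poly y) w
    extend-unique {G} y z F⊆H G⊆H z≡x z≡y {w} w⊆G = trans (coeff-extendedPoly G w⊆G) (case length w ℕ.≟ r of λ where
        (no ≢r) → trans (extendedCoeff-≢ w ≢r) (sym (inhomogeneous y ≢r))
        (yes e) → homogeneous-case (embed large w (ℕ.≤-reflexive e)))
      where
      homogeneous-case : (∃ λ π → All (_∈ F) (map (Inverse.to π) w)) → extendedCoeff w ≡ coeff (poly y) w
      homogeneous-case (π , πw⊆F) = begin
        extendedCoeff w                         ≡⟨ extendedCoeff-spec π πw⊆F ⟩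
        coeff (poly x) (map (Inverse.to π) w)   ≡⟨ z≡x πw⊆F ⟨
        coeff (poly z) (map (Inverse.to π) w)   ≡⟨ coeff-map z (to-injective π) (All.map G⊆H w⊆G) (All.map F⊆H πw⊆F) ⟩
        coeff (poly z) w                        ≡⟨ z≡y w⊆G ⟩
        coeff (poly y) w                        ∎
        where open ≡-Reasoning

  -- Each step kills only indeterminates outside the smaller set. The induction also carries the
  -- fact that `w` stays inside the growing sets.
  seq-coeff : ∀ (F : ℕ → List A) {Z : ℕ → Pred A 0ℓ} (Z? : ∀ i → Decidable (Z i))
    (F≐F∖Z : ∀ i → F i ≐ F (suc i) ∖ Z i) {r}
    (y : GradedRing.Carrier (Sequence.SequentialLimit (SymRing ∘ F) (λ i → setZeroHom (Z? i) (F≐F∖Z i))) r) →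
    ∀ {i j} → i ≤ j → ∀ {w} → All (_∈ F i) w → coeff (poly (at y j)) w ≡ coeff (poly (at y i)) w
  seq-coeff F Z? F≐F∖Z y {i} i≤j {w} w⊆F = proj₂ (go (ℕ.≤⇒≤′ i≤j))
    where
    go : ∀ {j} → i ≤′ j → All (_∈ F j) w × coeff (poly (at y j)) w ≡ coeff (poly (at y i)) w
    go (≤′-reflexive refl) = w⊆F , refl
    go (≤′-step {n = j} i≤j) with go i≤j
    ... | w⊆Fj , e = All.map (proj₁ ∘ Equivalence.to (F≐F∖Z j)) w⊆Fj ,
      trans (sym (coeff-setZeroSym (Z? j) (F≐F∖Z j) (at y (suc j)) w⊆Fj)) (trans (coeff-≡ (compatible y refl) w) e)

-- Coefficients along the maps between box rings and their limits.

module Boxes (n : ℕ) where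

  open Rings n
  open Extension (_≟ᵢ_ {n})

  private
    _≲_ : Monomial → List (Indeterminate n) → Set
    w ≲ F = All (_∈ F) w

  box-⊆ : ∀ {m m′ k k′} → m ≤ m′ → k ≤ k′ → box n m k ⊆ box n m′ k′
  box-⊆ {m} {m′} {k} {k′} m≤m′ k≤k′ a∈ with Equivalence.to (∈-box m k) a∈
  ... | p< , d≤ = Equivalence.from (∈-box m′ k′) (ℕ.≤-trans p< m≤m′ , ℕ.≤-trans d≤ k≤k′)

  box-⊆ˡ : ∀ k {m m′} → m ≤ m′ → box n m k ⊆ box n m′ k
  box-⊆ˡ k m≤m′ = box-⊆ {k = k} m≤m′ ℕ.≤-refl

  box-⊆ʳ : ∀ m {k k′} → k ≤ k′ → box n m k ⊆ box n m k′
  box-⊆ʳ m k≤k′ = box-⊆ {m = m} ℕ.≤-refl k≤k′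

  coeff-Λ[_,∙] : ∀ m {r} (y : GradedRing.Carrier Λ[ m ,∙] r) {k k′} → k ≤ k′ → ∀ {w} → w ≲ box n m k →
                 coeff (poly (at y k′)) w ≡ coeff (poly (at y k)) w
  coeff-Λ[ m ,∙] = seq-coeff (box n m) (λ k a → degree a ℕ.≟ suc k) (remove-degree m)

  coeff-Λ[∙,_] : ∀ k {r} (y : GradedRing.Carrier Λ[∙, k ] r) {i j} → i ≤ j → ∀ {w} → w ≲ box n (suc i) k →
                 coeff (poly (at y j)) w ≡ coeff (poly (at y i)) w
  coeff-Λ[∙, k ] = seq-coeff (λ i → box n (suc i) k) (λ i a → index a ℕ.≟ suc i) (λ i → remove-index (suc i) k)

  -- Every intermediate box contains the one for `m₁`, so no factor `hLim` kills an indeterminate of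
  -- `w`.
  coeff-φ : ∀ {m₁ m₂} (m₁≤m₂ : m₁ ≤ m₂) {r} (y : GradedRing.Carrier Λ[ m₂ ,∙] r) k {w} → w ≲ box n m₁ k →
            coeff (poly (at (⟦ φ m₁≤m₂ ⟧ y) k)) w ≡ coeff (poly (at y k)) w
  coeff-φ m₁≤m₂ y k {w} w≲ = composite-invariant Λ[_,∙] hLim (λ m y → coeff (poly (at y k)) w)
    (λ {m} m₁≤m y → coeff-setZeroSym (λ a → index a ℕ.≟ m) (remove-index m k) (at y k) (All.map (box-⊆ˡ k m₁≤m) w≲))
    m₁≤m₂ y

  coeff-ψ : ∀ {k₁ k₂} (k₁≤k₂ : k₁ ≤ k₂) {r} (y : GradedRing.Carrier Λ[∙, k₂ ] r) i {w} → w ≲ box n (suc i) k₁ →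
            coeff (poly (at (⟦ ψ k₁≤k₂ ⟧ y) i)) w ≡ coeff (poly (at y i)) w
  coeff-ψ k₁≤k₂ y i {w} w≲ = composite-invariant Λ[∙,_] vLim (λ k y → coeff (poly (at y i)) w)
    (λ {k} k₁≤k y → coeff-setZeroSym (λ a → degree a ℕ.≟ suc k) (remove-degree (suc i) k) (at y i)
      (All.map (box-⊆ʳ (suc i) k₁≤k) w≲))
    k₁≤k₂ y

  -- The indeterminates with `m ≤ index a` are already absent from the box, so position `k` is the
  -- plain truncation.
  coeff-H : ∀ m {r} (x : GradedRing.Carrier Λ r) k {w} → w ≲ box n m k →
            coeff (poly (at (⟦ H m ⟧ x) k)) w ≡ coeff (poly (at x (box n m k))) w
  coeff-H m x k = coeff-setZeroSym (λ a → m ℕ.≤? index a) (remove-no-index m k) (at x (box n m k))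

  coeff-V : ∀ k {r} (x : GradedRing.Carrier Λ r) i {w} → w ≲ box n (suc i) k →
            coeff (poly (at (⟦ V k ⟧ x) i)) w ≡ coeff (poly (at x (box n (suc i) k))) w
  coeff-V k x i = coeff-setZeroSym (λ a → k ℕ.<? degree a) (remove-no-degree (suc i) k) (at x (box n (suc i) k))

  -- Makes the maps `H` a cone over the family `φ`, and transfers surjectivity from `H` to `φ`.
  φ∘H : ∀ {m₁ m₂} (m₁≤m₂ : m₁ ≤ m₂) → φ m₁≤m₂ ∘ₕ H m₂ ≈ₕ H m₁
  φ∘H {m₁} {m₂} m₁≤m₂ x k = ≈-on (at (⟦ φ m₁≤m₂ ⟧ (⟦ H m₂ ⟧ x)) k) (at (⟦ H m₁ ⟧ x) k) λ w w≲ → begin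
    coeff (poly (at (⟦ φ m₁≤m₂ ⟧ (⟦ H m₂ ⟧ x)) k)) w  ≡⟨ coeff-φ m₁≤m₂ (⟦ H m₂ ⟧ x) k w≲ ⟩
    coeff (poly (at (⟦ H m₂ ⟧ x) k)) w                ≡⟨ coeff-H m₂ x k (All.map box₁⊆box₂ w≲) ⟩
    coeff (poly (at x (box n m₂ k))) w                ≡⟨ at-coeff x box₁⊆box₂ w≲ ⟩
    coeff (poly (at x (box n m₁ k))) w                ≡⟨ coeff-H m₁ x k w≲ ⟨
    coeff (poly (at (⟦ H m₁ ⟧ x) k)) w                ∎
    where
    open ≡-Reasoning
    box₁⊆box₂ : box n m₁ k ⊆ box n m₂ k
    box₁⊆box₂ = box-⊆ˡ k m₁≤m₂

  ψ∘V : ∀ {k₁ k₂} (k₁≤k₂ : k₁ ≤ k₂) → ψ k₁≤k₂ ∘ₕ V k₂ ≈ₕ V k₁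
  ψ∘V {k₁} {k₂} k₁≤k₂ x i = ≈-on (at (⟦ ψ k₁≤k₂ ⟧ (⟦ V k₂ ⟧ x)) i) (at (⟦ V k₁ ⟧ x) i) λ w w≲ → begin
    coeff (poly (at (⟦ ψ k₁≤k₂ ⟧ (⟦ V k₂ ⟧ x)) i)) w  ≡⟨ coeff-ψ k₁≤k₂ (⟦ V k₂ ⟧ x) i w≲ ⟩
    coeff (poly (at (⟦ V k₂ ⟧ x) i)) w                ≡⟨ coeff-V k₂ x i (All.map box₁⊆box₂ w≲) ⟩
    coeff (poly (at x (box n (suc i) k₂))) w          ≡⟨ at-coeff x box₁⊆box₂ w≲ ⟩
    coeff (poly (at x (box n (suc i) k₁))) w          ≡⟨ coeff-V k₁ x i w≲ ⟨
    coeff (poly (at (⟦ V k₁ ⟧ x) i)) w                ∎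
    where
    open ≡-Reasoning
    box₁⊆box₂ : box n (suc i) k₁ ⊆ box n (suc i) k₂
    box₁⊆box₂ = box-⊆ʳ (suc i) k₁≤k₂

  -- The directed families.

  -- Comparing coefficients avoids any analysis of how the order proofs split into steps.
  φ-isDirectedFamily : IsDirectedFamily ℕ⁺-directed (λ m → Λ[ proj₁ m ,∙]) φ
  φ-isDirectedFamily = record
    { identity = λ {(m , _)} m≤m x k → ≈-on (at (⟦ φ m≤m ⟧ x) k) (at x k) λ w → coeff-φ m≤m x k
    ; composition = λ {(m₁ , _)} m₁≤m₂ m₂≤m₃ m₁≤m₃ x k →
        ≈-on (at (⟦ φ m₁≤m₂ ⟧ (⟦ φ m₂≤m₃ ⟧ x)) k) (at (⟦ φ m₁≤m₃ ⟧ x) k) λ w w≲ →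
          trans (coeff-φ m₁≤m₂ (⟦ φ m₂≤m₃ ⟧ x) k w≲)
            (trans (coeff-φ m₂≤m₃ x k (All.map (box-⊆ˡ k m₁≤m₂) w≲)) (sym (coeff-φ m₁≤m₃ x k w≲)))
    }

  ψ-isDirectedFamily : IsDirectedFamily ℕ-directed Λ[∙,_] ψ
  ψ-isDirectedFamily = record
    { identity = λ k≤k x i → ≈-on (at (⟦ ψ k≤k ⟧ x) i) (at x i) λ w → coeff-ψ k≤k x i
    ; composition = λ k₁≤k₂ k₂≤k₃ k₁≤k₃ x i →
        ≈-on (at (⟦ ψ k₁≤k₂ ⟧ (⟦ ψ k₂≤k₃ ⟧ x)) i) (at (⟦ ψ k₁≤k₃ ⟧ x) i) λ w w≲ →
          trans (coeff-ψ k₁≤k₂ (⟦ ψ k₂≤k₃ ⟧ x) i w≲)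
            (trans (coeff-ψ k₂≤k₃ x i (All.map (box-⊆ʳ (suc i) k₁≤k₂) w≲)) (sym (coeff-ψ k₁≤k₃ x i w≲)))
    }

  -- Surjectivity of the maps from symmetric functions.

  -- Position `r` of `y` lives on a large box, and its extension is the preimage. Agreement at
  -- position `k` is checked through position `r ⊔ k`.
  H-surjective : 1 ≤ n → ∀ m → 1 ≤ m → ∀ {r} (y : GradedRing.Carrier Λ[ m ,∙] r) →
                 ∃ λ x → GradedRing._≈_ Λ[ m ,∙] (⟦ H m ⟧ x) y
  H-surjective 1≤n m 1≤m {r} y = x , λ k → ≈-on (at (⟦ H m ⟧ x) k) (at y k) λ w w≲ →
    trans (coeff-H m x k w≲)
      (extend-unique large (at y r) (at y k) (at y (r ℕ.⊔ k))
        (box-⊆ʳ m (ℕ.m≤m⊔n r k)) (box-⊆ʳ m (ℕ.m≤n⊔m r k))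
        (coeff-Λ[ m ,∙] y (ℕ.m≤m⊔n r k)) (coeff-Λ[ m ,∙] y (ℕ.m≤n⊔m r k)) w≲)
    where
    -- With `m` fixed, distinct indeterminates must come from longer words; powers of a single
    -- letter suffice, and `1 ≤ n` provides the letter.
    power : ℕ → Indeterminate n
    power d = 0 , replicate d (Fin.fromℕ< 1≤n)
    large : Large (box n m r) r
    large = injection⇒Large power
      (λ {i} {j} e → trans (sym (List.length-replicate i)) (trans (cong degree e) (List.length-replicate j)))
      (λ {i} i<r → Equivalence.from (∈-box m r) (1≤m , subst (_≤ r) (sym (List.length-replicate i)) (ℕ.<⇒≤ i<r)))
    x = extend large (at y r)

  V-surjective : ∀ k {r} (y : GradedRing.Carrier Λ[∙, k ] r) → ∃ λ x → GradedRing._≈_ Λ[∙, k ] (⟦ V k ⟧ x) y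
  V-surjective k {r} y = x , λ i → ≈-on (at (⟦ V k ⟧ x) i) (at y i) λ w w≲ →
    trans (coeff-V k x i w≲)
      (extend-unique large (at y r) (at y i) (at y (r ℕ.⊔ i))
        (box-⊆ˡ k (s≤s (ℕ.m≤m⊔n r i))) (box-⊆ˡ k (s≤s (ℕ.m≤n⊔m r i)))
        (coeff-Λ[∙, k ] y (ℕ.m≤m⊔n r i)) (coeff-Λ[∙, k ] y (ℕ.m≤n⊔m r i)) w≲)
    where
    -- Position `r` carries `m = suc r`; the empty word with the indices below `r` gives enough
    -- indeterminates.
    large : Large (box n (suc r) k) r
    large = injection⇒Large (λ p → p , []) (cong proj₁)
      (λ i<r → Equivalence.from (∈-box (suc r) k) (ℕ.m<n⇒m<1+n i<r , z≤n))
    x = extend large (at y r)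

  -- Symmetric functions recovered from their truncations to boxes.

  -- The box bounds the index strictly and the degree weakly, hence `suc` in the first only; it also
  -- makes `maxIndex` positive.
  maxIndex maxDegree : List (Indeterminate n) → ℕ
  maxIndex  F = suc (max 0 (map index F))
  maxDegree F = max 0 (map degree F)

  ⊆-box : ∀ F → F ⊆ box n (maxIndex F) (maxDegree F)
  ⊆-box F a∈F = Equivalence.from (∈-box (maxIndex F) (maxDegree F))
    ( s≤s (All.lookup (All.map⁻ (xs≤max 0 (map index F))) a∈F)
    , All.lookup (All.map⁻ (xs≤max 0 (map degree F))) a∈F )

  module _ {L : GradedRing} (p : ∀ m → 1 ≤ m → ∀ k → Hom L Λ[ m , k ])
           (coherent : ∀ {m m′ k k′} (1≤m : 1 ≤ m) (1≤m′ : 1 ≤ m′) → m ≤ m′ → k ≤ k′ →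
             ∀ {r} (y : GradedRing.Carrier L r) {w} → w ≲ box n m k →
             coeff (poly (⟦ p m′ 1≤m′ k′ ⟧ y)) w ≡ coeff (poly (⟦ p m 1≤m k ⟧ y)) w)
           where

    -- Boxes that are not nested are compared inside the box of the two maxima.
    coherent′ : ∀ {m m′ k k′} (1≤m : 1 ≤ m) (1≤m′ : 1 ≤ m′) {r} (y : GradedRing.Carrier L r) {w} →
                w ≲ box n m k → w ≲ box n m′ k′ →
                coeff (poly (⟦ p m 1≤m k ⟧ y)) w ≡ coeff (poly (⟦ p m′ 1≤m′ k′ ⟧ y)) w
    coherent′ {m} {m′} {k} {k′} 1≤m 1≤m′ y w≲ w≲′ = trans
      (sym (coherent 1≤m 1≤m⊔m′ (ℕ.m≤m⊔n m m′) (ℕ.m≤m⊔n k k′) y w≲))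
      (coherent 1≤m′ 1≤m⊔m′ (ℕ.m≤n⊔m m m′) (ℕ.m≤n⊔m k k′) y w≲′)
      where 1≤m⊔m′ = ℕ.≤-trans 1≤m (ℕ.m≤m⊔n m m′)

    private
      component : ∀ F → Hom L (SymRing F)
      component F = restrict (⊆-box F) ∘ₕ p (maxIndex F) (s≤s z≤n) (maxDegree F)

      -- The box around `F` used in `component` is an arbitrary choice; any other box containing the
      -- monomial gives the same coefficient.
      coeff-component : ∀ F {m k} (1≤m : 1 ≤ m) {r} (y : GradedRing.Carrier L r) {w} → w ≲ F → w ≲ box n m k →
                        coeff (poly (⟦ component F ⟧ y)) w ≡ coeff (poly (⟦ p m 1≤m k ⟧ y)) w
      coeff-component F 1≤m y w≲F w≲ = trans
        (coeff-restrict (⊆-box F) (⟦ p (maxIndex F) (s≤s z≤n) (maxDegree F) ⟧ y) w≲F)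
        (coherent′ {maxIndex F} {_} {maxDegree F} (s≤s z≤n) 1≤m y (All.map (⊆-box F) w≲F) w≲)

    glue : Hom L Λ
    glue = Limits.lift _⊆_ SymRing restrict component λ {F} {G} F⊆G y →
      ≈-on (⟦ restrict F⊆G ⟧ (⟦ component G ⟧ y)) (⟦ component F ⟧ y) λ w w≲F →
        -- The box around `G` serves as common ground for both components.
        let w≲box = All.map (⊆-box G ∘ F⊆G) w≲F in
        trans (coeff-restrict F⊆G (⟦ component G ⟧ y) w≲F)
          (trans (coeff-component G {maxIndex G} {maxDegree G} (s≤s z≤n) y (All.map F⊆G w≲F) w≲box)
            (sym (coeff-component F {maxIndex G} {maxDegree G} (s≤s z≤n) y w≲F w≲box)))

    -- `t` and `glue` both respect truncation to boxes. So do their composites, which are identities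
    -- because boxes determine elements of `L` by `ext` and elements of `Λ` by `⊆-box`.
    glue-iso : (t : Hom Λ L) → (∀ m (1≤m : 1 ≤ m) k → p m 1≤m k ∘ₕ t ≈ₕ truncate m k) →
               (∀ {r} {y z : GradedRing.Carrier L r} →
                 (∀ m (1≤m : 1 ≤ m) k → poly (⟦ p m 1≤m k ⟧ y) ≈ₚ poly (⟦ p m 1≤m k ⟧ z)) → GradedRing._≈_ L y z) →
               Σ (Iso Λ L) λ iso → ∀ m (1≤m : 1 ≤ m) k → p m 1≤m k ∘ₕ Iso.to iso ≈ₕ truncate m k
    glue-iso t p∘t ext = record
      { to      = t
      ; from    = glue
      ; to∘from = λ y → ext λ m 1≤m k → ≈-trans (p∘t m 1≤m k (⟦ glue ⟧ y))
          (≈-on (⟦ component (box n m k) ⟧ y) (⟦ p m 1≤m k ⟧ y) λ w w≲ → coeff-component (box n m k) 1≤m y w≲ w≲)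
      ; from∘to = λ x F → ≈-on (⟦ component F ⟧ (⟦ t ⟧ x)) (at x F) λ w w≲F →
          let w≲box = All.map (⊆-box F) w≲F in
          trans (coeff-component F {maxIndex F} {maxDegree F} (s≤s z≤n) (⟦ t ⟧ x) w≲F w≲box)
            (trans (coeff-≡ (p∘t (maxIndex F) (s≤s z≤n) (maxDegree F) x) w) (at-coeff x (⊆-box F) w≲F))
      } , p∘t

  limφ-iso : Σ (Iso Λ limφ) λ iso → ∀ m (1≤m : 1 ≤ m) k → projφ m 1≤m k ∘ₕ Iso.to iso ≈ₕ truncate m k
  limφ-iso = glue-iso projφ
    -- First `k′` is lowered to `k` inside the component at `m′`; then compatibility along `φ`
    -- lowers `m′` to `m`.
    (λ {m} {m′} {k} {k′} 1≤m 1≤m′ m≤m′ k≤k′ y {w} w≲ → trans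
      (coeff-Λ[ m′ ,∙] (at y (m′ , 1≤m′)) k≤k′ (All.map (box-⊆ˡ k m≤m′) w≲))
      (trans (sym (coeff-φ m≤m′ (at y (m′ , 1≤m′)) k w≲)) (coeff-≡ (compatible y {m , 1≤m} {m′ , 1≤m′} m≤m′ k) w)))
    (Limits.lift (DirectedSet._⊑_ ℕ⁺-directed) (λ m → Λ[ proj₁ m ,∙]) φ (λ m → H (proj₁ m)) φ∘H)
    (λ m 1≤m k x → ≈-on (at (⟦ H m ⟧ x) k) (at x (box n m k)) λ w → coeff-H m x k)
    (λ e (m , 1≤m) k → e m 1≤m k)

  limψ-iso : Σ (Iso Λ limψ) λ iso → ∀ m (1≤m : 1 ≤ m) k → projψ m 1≤m k ∘ₕ Iso.to iso ≈ₕ truncate m k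
  limψ-iso = glue-iso projψ
    -- The order is reversed: the position drops from `j` to `i` inside the component at `k′`, then
    -- `ψ` lowers `k′`.
    (λ { {suc i} {suc j} {k} {k′} _ _ (s≤s i≤j) k≤k′ y {w} w≲ → trans
      (coeff-Λ[∙, k′ ] (at y k′) i≤j (All.map (box-⊆ʳ (suc i) k≤k′) w≲))
      (trans (sym (coeff-ψ k≤k′ (at y k′) i w≲)) (coeff-≡ (compatible y k≤k′ i) w)) })
    (Limits.lift _≤_ Λ[∙,_] ψ V ψ∘V)
    (λ { (suc i) _ k x → ≈-on (at (⟦ V k ⟧ x) i) (at x (box n (suc i) k)) λ w → coeff-V k x i })
    (λ e k i → e (suc i) (s≤s z≤n) k)

theorem2 : (n : ℕ) → 1 ≤ n → let open Rings n in
    (∀ m₁ m₂ → 1 ≤ m₁ → (m₁≤m₂ : m₁ ≤ m₂) →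
    IsSurjectiveHomomorphism Λ[ m₂ ,∙] Λ[ m₁ ,∙] ⟦ φ m₁≤m₂ ⟧)
    × (∀ k₁ k₂ → (k₁≤k₂ : k₁ ≤ k₂) →
    IsSurjectiveHomomorphism Λ[∙, k₂ ] Λ[∙, k₁ ] ⟦ ψ k₁≤k₂ ⟧)
    × IsDirectedFamily ℕ⁺-directed (λ m → Λ[ proj₁ m ,∙]) φ
    × IsDirectedFamily ℕ-directed Λ[∙,_] ψ
    × (Σ (Iso Λ limφ) λ iso →
    ∀ m (1≤m : 1 ≤ m) k → projφ m 1≤m k ∘ₕ Iso.to iso ≈ₕ truncate m k)
    × (Σ (Iso Λ limψ) λ iso →
    ∀ m (1≤m : 1 ≤ m) k → projψ m 1≤m k ∘ₕ Iso.to iso ≈ₕ truncate m k)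
    × (∀ m → 1 ≤ m → IsSurjectiveHomomorphism Λ Λ[ m ,∙] ⟦ H m ⟧)
    × (∀ k → IsSurjectiveHomomorphism Λ Λ[∙, k ] ⟦ V k ⟧)
theorem2 n 1≤n =
    -- `H m₁` is surjective and factors through `φ m₁≤m₂`, so the latter is surjective in each
    -- degree.
    (λ m₁ m₂ 1≤m₁ m₁≤m₂ → componentwise-surjective (φ m₁≤m₂)
      (surjective-cancel (φ m₁≤m₂) (H m₂) (H m₁) (φ∘H m₁≤m₂) (H-surjective 1≤n m₁ 1≤m₁)))
  , (λ k₁ k₂ k₁≤k₂ → componentwise-surjective (ψ k₁≤k₂)
      (surjective-cancel (ψ k₁≤k₂) (V k₂) (V k₁) (ψ∘V k₁≤k₂) (V-surjective k₁)))
  , φ-isDirectedFamily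
  , ψ-isDirectedFamily
  , limφ-iso
  , limψ-iso
  , (λ m 1≤m → componentwise-surjective (H m) (H-surjective 1≤n m 1≤m))
  , (λ k → componentwise-surjective (V k) (V-surjective k))
  where
  open Rings n
  open Boxes n
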